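{- $\mathsf{P}\subseteq\mathsf{pc\text{ - }strong\text{ - }low\text{ - }CDEB}(\mathsf{con\text{ - }space},\infty\text{ - }\mathsf{time},\mathsf{con\text{ - }coin})$. That is, for every alphabet $\Sigma$, every language $L\subseteq\Sigma^*$ in $\mathsf{P}$ and every real $\varepsilon>0$, there is a complete-information debate system verifier $V$ (a finite-state verifier, with a finite prover alphabet $\Gamma_1$ and a disjoint finite refuter alphabet $\Gamma_0$) and a constant $c$ (both $V$ and $c$ may depend on $L$ and $\varepsilon$) such that $V$ tosses at most $c$ coins on every input, for every pair of player strategies, and for every sequence of coin outcomes, and such that \[ \forall w\in L\;\exists P\;\forall R:\ \operatorname{acc}_{V,P,R}(w)=1, \] \[ \forall w\in\Sigma^*\setminus L\;\forall P\;\exists R:\ \operatorname{rej}_{V,P,R}(w)\ge 1-\varepsilon, \] where $P$ ranges over all prover strategies and $R$ over all refuter strategies.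
   Context: $\mathsf{P}$ is the class of languages decidable in deterministic polynomial time. An alphabet $\Sigma$ is a finite nonempty set of symbols; $\triangleright,\triangleleft\notin\Sigma$ are distinct endmarkers. Complete-information debate system (CDS). There are three agents: a probabilistic verifier $V$, a prover $P$ and a refuter $R$. The verifier has finite-state memory (no work tape; this realizes the constant-space restriction), a single two-way head on a read-only input tape containing $\triangleright w\triangleleft$, where $w\in\Sigma^*$ is the input, and a single one-way head on a read-only debate tape. In a step the two-way head may move one cell left or right or stay in place; the one-way head may move one cell right or stay in place. The input head initially scans $\triangleright$ and the debate head initially scans the first debate symbol. The verifier's behavior is determined by its current state, the scanned input symbol, the scanned debate symbol, and the outcomes of independent fair coin tosses, which it may make at steps of its choosing (not every step need toss a coin). It may halt and accept, halt and reject, or run forever. $\Gamma_1$ and $\Gamma_0$ are disjoint finite alphabets of prover and refuter messages, and $\Gamma=\Gamma_1\cup\Gamma_0$. Strategies are arbitrary functions $P:\Sigma^*\times\Gamma^*\to\Gamma_1$ and $R:\Sigma^*\times\Gamma^*\to\Gamma_0$ (computationally unbounded; used on debate prefixes of even and odd length, respectively). On input $w$ they determine the infinite debate string $\gamma_1\gamma_2\cdots$ by $\gamma_j=P(w,\gamma_1\cdots\gamma_{j-1})$ for odd $j$ and $\gamma_j=R(w,\gamma_1\cdots\gamma_{j-1})$ for even $j$. The debate tape contains this string. The verifier's coins are private: the strategies do not depend on them. $\operatorname{acc}_{V,P,R}(w)$ and $\operatorname{rej}_{V,P,R}(w)$ are the probabilities, over the verifier's private coins, that $V$ halts and accepts,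 respectively halts and rejects, on input $w$ with players $P,R$; the remaining probability is that of nontermination. $\mathsf{pc\text{ - }strong\text{ - }low\text{ - }CDEB}(\mathsf{con\text{ - }space},\infty\text{ - }\mathsf{time},\mathsf{con\text{ - }coin})$ is the class of languages $L$ for which, for every $\varepsilon>0$, there is a CDS verifier $V$ satisfying the two displayed conditions in the claim (perfect completeness and strong error at most $\varepsilon$) that uses at most a constant amount of space (finite-state memory) and tosses at most a constant number of coins; these bounds may depend on $L$ and $\varepsilon$ but hold for every input, every pair of player strategies and every sequence of coin outcomes. No time bound is imposed on the verifier. -}

module Defs where

open import Data.Bool using (Bool; true; false)
open import Data.Fin using (Fin; zero; suc; pred)
open import Data.List using (List; []; _∷_; _∷ʳ_; length)
import Data.List as List
open import Data.Maybe using (Maybe; just; nothing)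
open import Data.Nat using (ℕ; zero; suc; parity) renaming (_+_ to _+ℕ_; _*_ to _*ℕ_; _^_ to _^ℕ_; _≤_ to _≤ℕ_)
open import Data.Parity using (Parity; 0ℙ; 1ℙ)
open import Data.Product using (Σ-syntax; ∃; ∃-syntax; _×_; _,_)
open import Data.Rational using (ℚ; 0ℚ; 1ℚ; ½; _+_; _*_; _-_; _<_)
open import Data.Sum using (_⊎_; inj₁; inj₂)
open import Data.Vec using (Vec; _∷_; fromList; lookup) renaming (map to mapᵛ; _∷ʳ_ to _∷ʳᵛ_)
open import Function.Bundles using (_↔_; _⇔_)
open import Level using (0ℓ)
open import Relation.Nullary using (¬_)
open import Relation.Unary using (Pred; _⊆_; _≐_)

-- Dedekind reals: lower q means q < x, upper q means x < q.
record ℝ : Set₁ where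
  field
    lower upper     : ℚ → Set
    lower-inhabited : ∃ lower
    upper-inhabited : ∃ upper
    lower-rounded   : ∀ q → lower q ⇔ (∃[ r ] q < r × lower r)
    upper-rounded   : ∀ q → upper q ⇔ (∃[ r ] r < q × upper r)
    disjoint        : ∀ q → ¬ (lower q × upper q)
    located         : ∀ q r → q < r → lower q ⊎ upper r

Positive : ℝ → Set
Positive x = ℝ.lower x 0ℚ

-- A real number given by the rationals strictly below it.  Halting
-- probabilities are suprema of increasing rational sequences, and such
-- suprema are constructively available only in this form.
LowerReal : Set₁
LowerReal = Pred ℚ 0ℓ

infix 4 _≈_ _≥_

_≈_ _≥_ : LowerReal → LowerReal → Set
x ≈ y = x ≐ y
x ≥ y = y ⊆ x

fromℚ : ℚ → LowerReal
fromℚ p q = q < p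

sup : (ℕ → ℚ) → LowerReal
sup s q = ∃[ t ] q < s t

-- q < 1 - x  iff  x < 1 - q.
1-_ : ℝ → LowerReal
(1- x) q = ℝ.upper x (1ℚ - q)

Finite : Set → Set
Finite A = ∃[ n ] (A ↔ Fin n)

record Alphabet : Set₁ where
  field
    Symbol  : Set
    size-1  : ℕ
    finite  : Symbol ↔ Fin (suc size-1)

open Alphabet public using (Symbol)

Word : Alphabet → Set
Word A = List (Symbol A)

Language : Alphabet → Set₁
Language A = Pred (Word A) 0ℓ

data Verdict : Set where
  accept reject : Verdict

data Direction : Set where
  left stay right : Direction

data Outcome (X : Set) : Set where
  continue : X → Outcome X
  halt     : Verdict → Outcome X

record TuringMachine (A : Alphabet) : Set₁ where
  field
    State        : Set
    state-finite : Finite State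
    Work         : Set
    work-finite  : Finite Work

  -- nothing is the blank; Work holds the tape symbols that are neither
  -- blank nor input symbols.
  Cell : Set
  Cell = Maybe (Symbol A ⊎ Work)

  field
    start : State
    δ     : State → Cell → Outcome (State × Cell × Direction)

module TM {A : Alphabet} (M : TuringMachine A) where
  open TuringMachine M

  -- A two-way infinite tape: the scanned cell and the cells to its left
  -- and right, nearest first; all cells beyond the two lists are blank.
  record Tape : Set where
    constructor tape
    field
      lefts   : List Cell
      scanned : Cell
      rights  : List Cell

  move : Direction → Tape → Tape
  move left  (tape []       x rs)       = tape [] nothing (x ∷ rs)
  move left  (tape (l ∷ ls) x rs)       = tape ls l (x ∷ rs)
  move stay  T                          = T
  move right (tape ls       x [])       = tape (x ∷ ls) nothing []
  move right (tape ls       x (r ∷ rs)) = tape (x ∷ ls) r rs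

  Config : Set
  Config = Outcome (State × Tape)

  inputSymbol : Symbol A → Cell
  inputSymbol a = just (inj₁ a)

  initialTape : Word A → Tape
  initialTape []      = tape [] nothing []
  initialTape (a ∷ w) = tape [] (inputSymbol a) (List.map inputSymbol w)

  step : Config → Config
  step (halt v) = halt v
  step (continue (q , tape ls x rs)) with δ q x
  ... | halt v                 = halt v
  ... | continue (q′ , y , d)  = continue (q′ , move d (tape ls y rs))

  run : ℕ → Word A → Config
  run zero    w = continue (start , initialTape w)
  run (suc t) w = step (run t w)

  data HaltsWith (v : Verdict) : Config → Set where
    halted : HaltsWith v (halt v)

  DecidesWithin : Language A → (ℕ → ℕ) → Set
  DecidesWithin L T = ∀ w → ∃[ t ] t ≤ℕ T (length w) ×
    ((L w × HaltsWith accept (run t w)) ⊎ (¬ L w × HaltsWith reject (run t w)))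

InP : (A : Alphabet) → Language A → Set₁
InP A L = Σ[ M ∈ TuringMachine A ] ∃[ c ] ∃[ k ]
  TM.DecidesWithin M L (λ n → c *ℕ n ^ℕ k +ℕ c)

data InputCell (A : Alphabet) : Set where
  ▷ ◁ : InputCell A
  sym : Symbol A → InputCell A

data DebateMove : Set where
  stay advance : DebateMove

-- A step either is deterministic or tosses one coin and depends on it.
data Step (X : Set) : Set where
  det  : X → Step X
  toss : (Bool → X) → Step X

record Verifier (A : Alphabet) : Set₁ where
  field
    State        : Set
    state-finite : Finite State
    Γ₁ Γ₀        : Alphabet

  -- The tagged union makes the two message alphabets disjoint.
  Γ : Set
  Γ = Symbol Γ₁ ⊎ Symbol Γ₀

  field
    start : State
    δ     : State → InputCell A → Γ → Step (Outcome (State × Direction × DebateMove))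

  Prover : Set
  Prover = Word A → List Γ → Symbol Γ₁

  Refuter : Set
  Refuter = Word A → List Γ → Symbol Γ₀

open Verifier public using (Prover; Refuter)

-- Moves off either end of the input tape leave the head in place; for
-- moves to the left, Data.Fin.pred behaves this way.
moveRight : ∀ {n} → Fin n → Fin n
moveRight {suc zero}    zero    = zero
moveRight {suc (suc n)} zero    = suc zero
moveRight               (suc i) = suc (moveRight i)

moveInput : ∀ {n} → Direction → Fin n → Fin n
moveInput left  i = pred i
moveInput stay  i = i
moveInput right i = moveRight i

moveDebate : DebateMove → ℕ → ℕ
moveDebate stay    j = j
moveDebate advance j = suc j

inputTape : ∀ {A} (w : Word A) → Vec (InputCell A) (suc (suc (length w)))
inputTape w = ▷ ∷ (mapᵛ sym (fromList w) ∷ʳᵛ ◁)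

module Debate {A : Alphabet} (V : Verifier A) (P : Prover V) (R : Refuter V) (w : Word A) where
  open Verifier V hiding (Prover; Refuter)

  -- The prover moves after prefixes of even length.
  reply : List Γ → Γ
  reply γs with parity (length γs)
  ... | 0ℙ = inj₁ (P w γs)
  ... | 1ℙ = inj₂ (R w γs)

  prefix : ℕ → List Γ
  prefix zero    = []
  prefix (suc n) = prefix n ∷ʳ reply (prefix n)

  -- Positions count from 0: debate j is the message γ_{j+1}.
  debate : ℕ → Γ
  debate j = reply (prefix j)

  Config : Set
  Config = Outcome (State × Fin (suc (suc (length w))) × ℕ)

  initial : Config
  initial = continue (start , zero , 0)

  perform : Fin (suc (suc (length w))) → ℕ → Outcome (State × Direction × DebateMove) → Config
  perform i j (halt v)               = halt v
  perform i j (continue (q , d , e)) = continue (q , moveInput d i , moveDebate e j)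

  next : Config → Step Config
  next (halt v) = det (halt v)
  next (continue (q , i , j)) with δ q (lookup (inputTape w) i) (debate j)
  ... | det a  = det (perform i j a)
  ... | toss f = toss (λ b → perform i j (f b))

  -- Number of coins tossed in the first t steps from a configuration; the
  -- stream ω supplies the outcomes of the successive tosses and is consumed
  -- only by steps that toss.
  tosses : (ω : ℕ → Bool) (t : ℕ) → Config → ℕ
  tosses ω zero    C = 0
  tosses ω (suc t) C with next C
  ... | det C′ = tosses ω t C′
  ... | toss f = suc (tosses (λ n → ω (suc n)) t (f (ω 0)))

  hasHalted : Verdict → Config → ℚ
  hasHalted accept (halt accept) = 1ℚ
  hasHalted reject (halt reject) = 1ℚ
  hasHalted _      _             = 0ℚ

  -- Probability, over independent fair coins, of having halted with verdict
  -- v after t steps from a configuration.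
  haltsWithin : Verdict → (t : ℕ) → Config → ℚ
  haltsWithin v zero    C = hasHalted v C
  haltsWithin v (suc t) C with next C
  ... | det C′ = haltsWithin v t C′
  ... | toss f = ½ * haltsWithin v t (f true) + ½ * haltsWithin v t (f false)

module _ {A : Alphabet} (V : Verifier A) where

  -- The event of ever halting with a given verdict is the increasing union
  -- of the events of having done so within t steps.
  acc rej : Prover V → Refuter V → Word A → LowerReal
  acc P R w = sup (λ t → haltsWithin accept t initial) where open Debate V P R w
  rej P R w = sup (λ t → haltsWithin reject t initial) where open Debate V P R w

  TossesAtMost : ℕ → Set
  TossesAtMost c = ∀ w P R ω t → Debate.tosses V P R w ω t (Debate.initial V P R w) ≤ℕ c

{-# OPTIONS --safe #-}
module Submission where

-- Prover and refuter debate on claims "at time t the machine is in state q and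
-- the cell at distance i from its head contains x".  The prover backs a claim by
-- naming the state and the scanned symbol at time t - 1, which leaves two claims
-- about time t - 1, and the refuter picks the one to pursue; claims about time 0
-- are checked on the input.  The counters t and i are written in base n + 2, so
-- that a digit is a position of the input head; to count, the prover names the
-- digit at which the carry or borrow stops, and so every assertion can be tested
-- digit by digit.
-- The verifier secretly tracks one random digit, and the refuter stops the
-- debate as soon as the prover lies about some digit, so that each debate about
-- a false claim is rejected with constant probability.  Repeating the debate
-- makes the error small, and an honest prover is never rejected.

open import Defs
open import Data.Bool using (Bool; true; false; not; if_then_else_)
import Data.Bool.Properties as Bool
open import Data.Empty using (⊥)
open import Data.Fin using (Fin; zero; suc; toℕ; fromℕ; fromℕ<; inject₁)
open import Data.Fin.Induction using (<-weakInduction; >-weakInduction)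
open import Data.Fin.Properties as Fin using (toℕ-fromℕ; toℕ-fromℕ<; toℕ-inject₁; toℕ<n; ≤fromℕ; all?; ¬∀⟶∃¬; +↔⊎; *↔×; 2↔Bool)
open import Data.Fin.Relation.Unary.Top using (view; ‵fromℕ; ‵inject₁)
import Data.Integer as ℤ
import Data.Integer.Properties as ℤ
open import Data.List as List using (List; []; _∷_; length; foldl)
open import Data.List.Properties using (length-++; foldl-∷ʳ)
open import Data.Maybe as Maybe using (Maybe; just; nothing; maybe′)
open import Data.Nat as ℕ using (ℕ; zero; suc; z≤n; s≤s; parity)
import Data.Nat.Properties as ℕ
import Data.Nat.Solver as ℕ-Solver
open import Data.Parity using (0ℙ; 1ℙ)
open import Data.Product using (Σ-syntax; ∃-syntax; _×_; _,_; proj₁; proj₂)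
open import Data.Product.Function.NonDependent.Propositional using (_×-↔_)
open import Data.Rational as ℚ using (ℚ; 0ℚ; 1ℚ; ½)
import Data.Rational.Properties as ℚ
import Data.Rational.Solver as ℚ-Solver
import Data.Rational.Unnormalised as ℚᵘ
import Data.Rational.Unnormalised.Properties as ℚᵘ
open import Data.Sum using (_⊎_; inj₁; inj₂)
open import Data.Sum.Function.Propositional using (_⊎-↔_)
open import Data.Unit using (⊤; tt)
open import Data.Vec using (Vec; []; _∷_; lookup; fromList) renaming (map to mapᵛ; _∷ʳ_ to _∷ʳᵛ_)
open import Function.Base using (_∘_)
open import Function.Bundles using (_↔_; mk↔ₛ′; Inverse; Equivalence)
open import Function.Construct.Composition using (_↔-∘_)
open import Function.Construct.Identity using (↔-id)
open import Function.Construct.Symmetry using (↔-sym)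
open import Function.Properties.Inverse using (↔⇒↣)
open import Relation.Binary.Definitions using (DecidableEquality; tri<; tri≈; tri>)
open import Relation.Binary.PropositionalEquality renaming (sym to ≡-sym)
open import Relation.Nullary using (¬_; Dec; yes; no; does; contradiction)
open import Relation.Nullary.Decidable using (map′; dec-true; _×-dec_)

-- The intermediate object, `Game`, is in essence an alternating finite automaton with several
-- two-way input heads; such automata capture exactly P. The obstacle is that the verifier owns a
-- single input head and can follow only one virtual head at a time. What saves it is that the
-- debate fixes the movements of all virtual heads and does not depend on the coins: a move that
-- fails the test of some head fails it whichever head is tracked, and that head is the tracked one
-- with a probability bounded below in terms of the number of heads.
--
-- A stop called by the refuter proves nothing to a verifier that tracks another head. Rejecting on
-- it would hurt honest provers, so it merely ends the round, and the last round ends in acceptance.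
--
-- Addresses are relative to the machine's head because a step then changes the index by at most
-- one, and no two counters ever have to be compared. Every legal move except the final appeal to
-- the input uses up a tick of the clock, so the debate on a claim is finite although the verifier
-- has no time bound.

module _ where
  open import Data.Rational using (_+_; _*_; _-_; _≤_; _<_)
  open import Data.Rational using (mkℚ; *<*; _/_; toℚᵘ; positive; nonNegative)
  open import Data.Integer using (+_; +[1+_]; +≤+)

  -- Halting probabilities

  ½-mix : ∀ {p p′ q q′} → p ≤ p′ → q ≤ q′ → ½ * p + ½ * q ≤ ½ * p′ + ½ * q′
  ½-mix p≤p′ q≤q′ = ℚ.+-mono-≤ (ℚ.*-monoˡ-≤-nonNeg ½ p≤p′) (ℚ.*-monoˡ-≤-nonNeg ½ q≤q′)

  ½-mix-idem : ∀ p → ½ * p + ½ * p ≡ p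
  ½-mix-idem p = trans (≡-sym (ℚ.*-distribʳ-+ p ½ ½)) (ℚ.*-identityˡ p)

  module Probability {A : Alphabet} (V : Verifier A) (P : Prover V) (R : Refuter V) (w : Word A) where
    open Verifier V hiding (Prover; Refuter)
    open Debate V P R w

    haltsWithin-det : ∀ v t {C C′} → next C ≡ det C′ → haltsWithin v (suc t) C ≡ haltsWithin v t C′
    haltsWithin-det v t eq rewrite eq = refl

    haltsWithin-toss : ∀ v t {C f} → next C ≡ toss f →
      haltsWithin v (suc t) C ≡ ½ * haltsWithin v t (f true) + ½ * haltsWithin v t (f false)
    haltsWithin-toss v t eq rewrite eq = refl

    0≤hasHalted : ∀ v C → 0ℚ ≤ hasHalted v C
    0≤hasHalted accept (halt accept)  = ℚ.nonNegative⁻¹ 1ℚ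
    0≤hasHalted accept (halt reject)  = ℚ.≤-refl
    0≤hasHalted accept (continue _)   = ℚ.≤-refl
    0≤hasHalted reject (halt accept)  = ℚ.≤-refl
    0≤hasHalted reject (halt reject)  = ℚ.nonNegative⁻¹ 1ℚ
    0≤hasHalted reject (continue _)   = ℚ.≤-refl

    hasHalted≤1 : ∀ v C → hasHalted v C ≤ 1ℚ
    hasHalted≤1 accept (halt accept)  = ℚ.≤-refl
    hasHalted≤1 accept (halt reject)  = ℚ.nonNegative⁻¹ 1ℚ
    hasHalted≤1 accept (continue _)   = ℚ.nonNegative⁻¹ 1ℚ
    hasHalted≤1 reject (halt accept)  = ℚ.nonNegative⁻¹ 1ℚ
    hasHalted≤1 reject (halt reject)  = ℚ.≤-refl
    hasHalted≤1 reject (continue _)   = ℚ.nonNegative⁻¹ 1ℚ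

    0≤haltsWithin : ∀ v t C → 0ℚ ≤ haltsWithin v t C
    0≤haltsWithin v zero    C = 0≤hasHalted v C
    0≤haltsWithin v (suc t) C with next C
    ... | det C′ = 0≤haltsWithin v t C′
    ... | toss f = ½-mix (0≤haltsWithin v t (f true)) (0≤haltsWithin v t (f false))

    haltsWithin≤1 : ∀ v t C → haltsWithin v t C ≤ 1ℚ
    haltsWithin≤1 v zero    C = hasHalted≤1 v C
    haltsWithin≤1 v (suc t) C with next C
    ... | det C′ = haltsWithin≤1 v t C′
    ... | toss f = ½-mix (haltsWithin≤1 v t (f true)) (haltsWithin≤1 v t (f false))

    hasHalted-continue : ∀ v x → hasHalted v (continue x) ≡ 0ℚ
    hasHalted-continue accept x = refl
    hasHalted-continue reject x = refl

    haltsWithin-suc : ∀ v t C → haltsWithin v t C ≤ haltsWithin v (suc t) C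
    haltsWithin-suc v zero    (halt u)     = ℚ.≤-refl
    haltsWithin-suc v zero    (continue x) =
      subst (_≤ haltsWithin v 1 (continue x)) (≡-sym (hasHalted-continue v x)) (0≤haltsWithin v 1 (continue x))
    haltsWithin-suc v (suc t) C with next C
    ... | det C′ = haltsWithin-suc v t C′
    ... | toss f = ½-mix (haltsWithin-suc v t (f true)) (haltsWithin-suc v t (f false))

    -- The two branches of a toss may need different numbers of steps; monotonicity lets `toss-prob`
    -- bring them to a common one.
    haltsWithin-mono : ∀ v s t C → haltsWithin v t C ≤ haltsWithin v (s ℕ.+ t) C
    haltsWithin-mono v zero    t C = ℚ.≤-refl
    haltsWithin-mono v (suc s) t C = ℚ.≤-trans (haltsWithin-mono v s t C) (haltsWithin-suc v (s ℕ.+ t) C)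

    -- The bound is attained after finitely many steps, which is more than a bound on the supremum.
    -- The strategies constructed below achieve this, and the statements about lower reals follow at
    -- once.
    HaltsWithProb : Verdict → ℚ → Config → Set
    HaltsWithProb v p C = ∃[ t ] p ≤ haltsWithin v t C

    weaken : ∀ {v p q C} → p ≤ q → HaltsWithProb v q C → HaltsWithProb v p C
    weaken p≤q (t , q≤) = t , ℚ.≤-trans p≤q q≤

    0-prob : ∀ {v C} → HaltsWithProb v 0ℚ C
    0-prob {v} {C} = 0 , 0≤haltsWithin v 0 C

    rejected : HaltsWithProb reject 1ℚ (halt reject)
    rejected = 0 , ℚ.≤-refl

    accepted : HaltsWithProb accept 1ℚ (halt accept)
    accepted = 0 , ℚ.≤-refl

    det-prob : ∀ {v p q i j a} → δ q (lookup (inputTape w) i) (debate j) ≡ det a →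
      HaltsWithProb v p (perform i j a) → HaltsWithProb v p (continue (q , i , j))
    det-prob {v} {p} {q} {i} {j} {a} eq (t , p≤) =
      suc t , subst (p ≤_) (≡-sym (haltsWithin-det v t (next-det eq))) p≤
      where
      next-det : δ q (lookup (inputTape w) i) (debate j) ≡ det a → next (continue (q , i , j)) ≡ det (perform i j a)
      next-det eq rewrite eq = refl

    toss-prob : ∀ {v p p′ q i j f} → δ q (lookup (inputTape w) i) (debate j) ≡ toss f →
      HaltsWithProb v p (perform i j (f true)) → HaltsWithProb v p′ (perform i j (f false)) →
      HaltsWithProb v (½ * p + ½ * p′) (continue (q , i , j))
    toss-prob {v} {p} {p′} {q} {i} {j} {f} eq (s , p≤) (t , p′≤) =
      suc (s ℕ.+ t) , subst (½ * p + ½ * p′ ≤_) (≡-sym (haltsWithin-toss v (s ℕ.+ t) (next-toss eq)))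
        (½-mix (ℚ.≤-trans p≤ (subst (λ u → haltsWithin v s C₁ ≤ haltsWithin v u C₁) (ℕ.+-comm t s) (haltsWithin-mono v t s C₁)))
               (ℚ.≤-trans p′≤ (haltsWithin-mono v s t (perform i j (f false)))))
      where
      C₁ = perform i j (f true)
      next-toss : δ q (lookup (inputTape w) i) (debate j) ≡ toss f →
        next (continue (q , i , j)) ≡ toss (λ b → perform i j (f b))
      next-toss eq rewrite eq = refl

    length-prefix : ∀ j → length (prefix j) ≡ j
    length-prefix zero    = refl
    length-prefix (suc j) = trans (length-++ (prefix j)) (trans (ℕ.+-comm (length (prefix j)) 1) (cong suc (length-prefix j)))

    debate-even : ∀ {j} → parity j ≡ 0ℙ → debate j ≡ inj₁ (P w (prefix j))
    debate-even {j} even = reply-even (prefix j) (trans (cong parity (length-prefix j)) even)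
      where
      reply-even : ∀ γs → parity (length γs) ≡ 0ℙ → reply γs ≡ inj₁ (P w γs)
      reply-even γs even with parity (length γs)
      ... | 0ℙ = refl

    debate-odd : ∀ {j} → parity j ≡ 1ℙ → debate j ≡ inj₂ (R w (prefix j))
    debate-odd {j} odd = reply-odd (prefix j) (trans (cong parity (length-prefix j)) odd)
      where
      reply-odd : ∀ γs → parity (length γs) ≡ 1ℙ → reply γs ≡ inj₂ (R w γs)
      reply-odd γs odd with parity (length γs)
      ... | 1ℙ = refl

    foldl-prefix : ∀ {X : Set} (f : X → Γ → X) x j →
      foldl f x (prefix (suc j)) ≡ f (foldl f x (prefix j)) (debate j)
    foldl-prefix f x j = foldl-∷ʳ f x (debate j) (prefix j)

  parity-suc : ∀ {j} → parity j ≡ 0ℙ → parity (suc j) ≡ 1ℙ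
  parity-suc {zero}        even = refl
  parity-suc {suc (suc j)} even = parity-suc {j} even

  -- Amplification

  -- A lower bound for the rejection probability of a round: one of the heads
  -- 0, …, h is certain to reject, the others reject with probability p, and
  -- each head is chosen with probability at least 2^-h.
  improve : ℕ → ℚ → ℚ
  improve zero    p = 1ℚ
  improve (suc h) p = ½ * p + ½ * improve h p

  ½^_ : ℕ → ℚ
  ½^ zero  = 1ℚ
  ½^ suc h = ½ * (½^ h)

  ½^-positive : ∀ h → 0ℚ < ½^ h
  ½^-positive zero    = ℚ.positive⁻¹ 1ℚ
  ½^-positive (suc h) = subst (_< ½ * (½^ h)) (ℚ.*-zeroʳ ½) (ℚ.*-monoʳ-<-pos ½ (½^-positive h))

  improve≤1 : ∀ h {p} → p ≤ 1ℚ → improve h p ≤ 1ℚ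
  improve≤1 zero    p≤1 = ℚ.≤-refl
  improve≤1 (suc h) p≤1 = ½-mix p≤1 (improve≤1 h p≤1)

  p≤improve : ∀ h {p} → p ≤ 1ℚ → p ≤ improve h p
  p≤improve zero    p≤1 = p≤1
  p≤improve (suc h) {p} p≤1 = subst (_≤ improve (suc h) p) (½-mix-idem p) (½-mix (ℚ.≤-refl {p}) (p≤improve h p≤1))

  -- A round misses only if the sure head, of weight `½^ h`, is not tracked and the later rounds
  -- miss as well. So each round multiplies the error by the constant `1ℚ - ½^ h`.
  1-improve : ∀ h p → 1ℚ - improve h p ≡ (1ℚ - ½^ h) * (1ℚ - p)
  1-improve zero p = trans (ℚ.+-inverseʳ 1ℚ) (≡-sym (ℚ.*-zeroˡ (1ℚ - p)))
  1-improve (suc h) p = trans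
    (solve 2 (λ p x → con 1ℚ :- (con ½ :* p :+ con ½ :* x) := con ½ :* (con 1ℚ :- p) :+ con ½ :* (con 1ℚ :- x)) refl p (improve h p))
    (trans (cong (λ x → ½ * (1ℚ - p) + ½ * x) (1-improve h p))
    (solve 2 (λ p x → con ½ :* (con 1ℚ :- p) :+ con ½ :* ((con 1ℚ :- x) :* (con 1ℚ :- p))
        := (con 1ℚ :- con ½ :* x) :* (con 1ℚ :- p)) refl p (½^ h)))
    where open ℚ-Solver.+-*-Solver

  bound : ℕ → ℕ → ℚ
  bound h zero    = 0ℚ
  bound h (suc m) = improve h (bound h m)

  bound≤1 : ∀ h m → bound h m ≤ 1ℚ
  bound≤1 h zero    = ℚ.nonNegative⁻¹ 1ℚ
  bound≤1 h (suc m) = improve≤1 h (bound≤1 h m)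

  times : ℕ → ℚ → ℚ
  times zero    p = 0ℚ
  times (suc m) p = p + times m p

  times-nonneg : ∀ m {p} → 0ℚ ≤ p → 0ℚ ≤ times m p
  times-nonneg zero    0≤p = ℚ.≤-refl
  times-nonneg (suc m) 0≤p = ℚ.+-mono-≤ 0≤p (times-nonneg m 0≤p)

  times-* : ∀ m p q → times m p * q ≡ times m (p * q)
  times-* zero    p q = ℚ.*-zeroˡ q
  times-* (suc m) p q = trans (ℚ.*-distribʳ-+ q p (times m p)) (cong (λ x → p * q + x) (times-* m p q))

  0≤1-p : ∀ {p} → p ≤ 1ℚ → 0ℚ ≤ 1ℚ - p
  0≤1-p {p} p≤1 = subst (_≤ 1ℚ - p) (ℚ.+-inverseʳ p) (ℚ.+-monoˡ-≤ (ℚ.- p) p≤1)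

  *-nonneg : ∀ {p q} → 0ℚ ≤ p → 0ℚ ≤ q → 0ℚ ≤ p * q
  *-nonneg {p} {q} 0≤p 0≤q = subst (_≤ p * q) (ℚ.*-zeroʳ p) (ℚ.*-monoˡ-≤-nonNeg p {{nonNegative 0≤p}} 0≤q)

  -- Bernoulli's inequality, in the form (1 - δ)ᵐ (1 + m δ) ≤ 1.
  bernoulli : ∀ h m → (1ℚ - bound h m) * (1ℚ + times m (½^ h)) ≤ 1ℚ
  bernoulli h zero    = ℚ.≤-refl
  bernoulli h (suc m) = ℚ.≤-trans (ℚ.≤-trans (ℚ.≤-reflexive expand) decrease) (bernoulli h m)
    where
    open ℚ-Solver.+-*-Solver
    e = 1ℚ - bound h m
    δ = ½^ h
    s = times m δ
    0≤δ = ℚ.<⇒≤ (½^-positive h)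
    -- (1 - δ)(1 + δ + s) = (1 + s) - δδ - δs: the new round only subtracts nonnegative terms.
    expand : (1ℚ - bound h (suc m)) * (1ℚ + times (suc m) δ) ≡ e * (1ℚ + s) - (e * (δ * δ) + e * (δ * s))
    expand = trans (cong (_* (1ℚ + times (suc m) δ)) (1-improve h (bound h m)))
      (solve 3 (λ e d s → (con 1ℚ :- d) :* e :* (con 1ℚ :+ (d :+ s))
        := e :* (con 1ℚ :+ s) :- (e :* (d :* d) :+ e :* (d :* s))) refl e δ s)
    0≤e = 0≤1-p (bound≤1 h m)
    decrease : e * (1ℚ + s) - (e * (δ * δ) + e * (δ * s)) ≤ e * (1ℚ + s)
    decrease = ℚ.≤-trans
      (ℚ.+-monoʳ-≤ (e * (1ℚ + s)) (ℚ.neg-antimono-≤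
        (ℚ.+-mono-≤ (*-nonneg 0≤e (*-nonneg 0≤δ 0≤δ)) (*-nonneg 0≤e (*-nonneg 0≤δ (times-nonneg m 0≤δ))))))
      (ℚ.≤-reflexive (ℚ.+-identityʳ _))

  1/suc : ℕ → ℚ
  1/suc d = + 1 / suc d

  times-1/suc : ∀ m d → toℚᵘ (times m (1/suc d)) ℚᵘ.≃ ℚᵘ.mkℚᵘ (+ m) d
  times-1/suc zero    d = ℚᵘ.*≡* refl
  times-1/suc (suc m) d = ℚᵘ.≃-trans (ℚ.toℚᵘ-homo-+ (1/suc d) (times m (1/suc d)))
    (ℚᵘ.≃-trans (ℚᵘ.+-cong (ℚ.toℚᵘ-fromℚᵘ (ℚᵘ.mkℚᵘ (+ 1) d)) (times-1/suc m d))
      (ℚᵘ.*≡* (trans (cong (ℤ._* + suc d) (≡-sym (ℤ.*-distribʳ-+ (+ suc d) (+ 1) (+ m))))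
        (ℤ.*-assoc (+ suc m) (+ suc d) (+ suc d)))))

  times-mono : ∀ m {p q} → p ≤ q → times m p ≤ times m q
  times-mono zero    p≤q = ℚ.≤-refl
  times-mono (suc m) p≤q = ℚ.+-mono-≤ p≤q (times-mono m p≤q)

  archimedean : ∀ p → 0ℚ < p → ∃[ m ] 1ℚ ≤ times m p
  archimedean (mkℚ (+ 0) d c)      (*<* (ℤ.+<+ ()))
  archimedean (mkℚ (ℤ.-[1+ _ ]) d c) (*<* ())
  -- A positive numerator is at least 1, so as many copies as the denominator says add up to at
  -- least 1.
  archimedean p@(mkℚ +[1+ n ] d c) 0<p = suc d , ℚ.≤-trans
    (ℚ.≤-reflexive (ℚ.toℚᵘ-injective (ℚᵘ.≃-sym (ℚᵘ.≃-trans (times-1/suc (suc d) d) (ℚᵘ.*≡* (ℤ.*-comm (+ suc d) (+ 1)))))))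
    (times-mono (suc d) (ℚ.toℚᵘ-cancel-≤ (ℚᵘ.≤-respˡ-≃ (ℚᵘ.≃-sym (ℚ.toℚᵘ-fromℚᵘ (ℚᵘ.mkℚᵘ (+ 1) d)))
      (ℚᵘ.*≤* (ℤ.*-monoʳ-≤-nonNeg (+ suc d) (+≤+ (s≤s (z≤n {n}))))))))

  -- Let s be `m` times `½^ h`, with `m` so large that s r is at least 1. Bernoulli's inequality
  -- bounds the error times 1 + s by 1, hence by s r and by r (1 + s), and the factor 1 + s cancels.
  bound-tends-to-1 : ∀ h r → 0ℚ < r → ∃[ m ] 1ℚ - bound h m ≤ r
  bound-tends-to-1 h r 0<r with archimedean (½^ h * r) 0<δr
    where
    0<δr = subst (_< ½^ h * r) (ℚ.*-zeroʳ (½^ h)) (ℚ.*-monoʳ-<-pos (½^ h) {{positive (½^-positive h)}} 0<r)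
  ... | m , 1≤mδr = m , ℚ.*-cancelʳ-≤-pos (1ℚ + s) {{positive 0<1+s}}
      (ℚ.≤-trans (bernoulli h m) (ℚ.≤-trans (subst (1ℚ ≤_) (≡-sym (times-* m (½^ h) r)) 1≤mδr)
        (ℚ.≤-trans (subst (s * r ≤_) (ℚ.+-comm (s * r) r) (subst (_≤ s * r + r) (ℚ.+-identityʳ (s * r)) (ℚ.+-monoʳ-≤ (s * r) (ℚ.<⇒≤ 0<r))))
          (ℚ.≤-reflexive (solve 2 (λ s r → r :+ s :* r := r :* (con 1ℚ :+ s)) refl s r)))))
    where
    open ℚ-Solver.+-*-Solver
    s = times m (½^ h)
    0<1+s : 0ℚ < 1ℚ + s
    0<1+s = ℚ.+-mono-<-≤ (ℚ.positive⁻¹ 1ℚ) (times-nonneg m (ℚ.<⇒≤ (½^-positive h)))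

  lower<upper : ∀ (x : ℝ) {p q} → ℝ.lower x p → ℝ.upper x q → p < q
  lower<upper x {p} {q} lo up with ℚ.<-cmp p q
  ... | tri< p<q _ _    = p<q
  ... | tri≈ _ refl _   = contradiction (lo , up) (ℝ.disjoint x p)
  ... | tri> _ _ q<p    = contradiction (Equivalence.from (ℝ.lower-rounded x q) (p , q<p , lo) , up) (ℝ.disjoint x q)

-- Finite sets

⊤-finite : Finite ⊤
⊤-finite = 1 , mk↔ₛ′ (λ _ → zero) (λ _ → tt) (λ { zero → refl }) (λ _ → refl)

Bool-finite : Finite Bool
Bool-finite = 2 , ↔-sym 2↔Bool

Fin-finite : ∀ n → Finite (Fin n)
Fin-finite n = n , ↔-id (Fin n)

⊎-finite : ∀ {X Y} → Finite X → Finite Y → Finite (X ⊎ Y)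
⊎-finite (m , f) (n , g) = m ℕ.+ n , (↔-sym +↔⊎ ↔-∘ (f ⊎-↔ g))

×-finite : ∀ {X Y} → Finite X → Finite Y → Finite (X × Y)
×-finite (m , f) (n , g) = m ℕ.* n , (↔-sym *↔× ↔-∘ (f ×-↔ g))

Maybe↔ : ∀ {X : Set} {n} → X ↔ Fin n → Maybe X ↔ Fin (suc n)
Maybe↔ {X} {n} f = mk↔ₛ′ to from to∘from from∘to
  where
  module f = Inverse f
  to : Maybe X → Fin (suc n)
  to nothing  = zero
  to (just x) = suc (f.to x)
  from : Fin (suc n) → Maybe X
  from zero    = nothing
  from (suc i) = just (f.from i)
  to∘from : ∀ i → to (from i) ≡ i
  to∘from zero    = refl
  to∘from (suc i) = cong suc (f.strictlyInverseˡ i)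
  from∘to : ∀ x → from (to x) ≡ x
  from∘to nothing  = refl
  from∘to (just x) = cong just (f.strictlyInverseʳ x)

Maybe-finite : ∀ {X} → Finite X → Finite (Maybe X)
Maybe-finite (n , f) = suc n , Maybe↔ f

-- Games with heads on the input tape

pattern ▷-end = false
pattern ◁-end = true

data Action : Set where
  move : Direction → Action
  goto : Bool → Action

-- In each turn the prover names a move, which must pass a test by every head
-- on the cell it scans, and the refuter answers with a bit; next = nothing
-- ends the game with a win for the prover.
record Game (A : Alphabet) : Set₁ where
  field
    Control        : Set
    control-finite : Finite Control
    Moves Heads    : Alphabet
    initial        : Control
    home           : Symbol Heads → Bool
    test           : Control → Symbol Moves → Symbol Heads → InputCell A → Bool
    next           : Control → Symbol Moves → Bool → Maybe Control
    act            : Control → Symbol Moves → Bool → Symbol Heads → Action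

isEnd : ∀ {A} → Bool → InputCell A → Bool
isEnd ▷-end ▷       = true
isEnd ▷-end ◁       = false
isEnd ▷-end (sym _) = false
isEnd ◁-end ▷       = false
isEnd ◁-end ◁       = true
isEnd ◁-end (sym _) = false

endpoint : ∀ {n} → Bool → Fin (suc n)
endpoint ▷-end = zero
endpoint ◁-end = fromℕ _

applyAction : ∀ {n} → Action → Fin (suc n) → Fin (suc n)
applyAction (move d) = moveInput d
applyAction (goto e) _ = endpoint e

module InputTape (A : Alphabet) (w : Word A) where

  closed : ∀ {n} → Vec (Symbol A) n → Vec (InputCell A) (suc n)
  closed cs = mapᵛ sym cs ∷ʳᵛ ◁

  cellAt : Fin (suc (suc (length w))) → InputCell A
  cellAt = lookup (inputTape w)

  lookup-last : ∀ {n} (cs : Vec (Symbol A) n) → lookup (closed cs) (fromℕ n) ≡ ◁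
  lookup-last []       = refl
  lookup-last (_ ∷ cs) = lookup-last cs

  lookup-inner : ∀ {n} (cs : Vec (Symbol A) n) i → lookup (closed cs) (inject₁ i) ≡ sym (lookup cs i)
  lookup-inner (_ ∷ cs) zero    = refl
  lookup-inner (_ ∷ cs) (suc i) = lookup-inner cs i

  lookup-not-▷ : ∀ {n} (cs : Vec (Symbol A) n) i → isEnd ▷-end (lookup (closed cs) i) ≡ false
  lookup-not-▷ []       zero    = refl
  lookup-not-▷ (_ ∷ cs) zero    = refl
  lookup-not-▷ (_ ∷ cs) (suc i) = lookup-not-▷ cs i

  isEnd-endpoint : ∀ e → isEnd e (cellAt (endpoint e)) ≡ true
  isEnd-endpoint ▷-end = refl
  isEnd-endpoint ◁-end = cong (isEnd ◁-end) (lookup-last (fromList w))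

  isEnd-◁-inject₁ : ∀ i → isEnd ◁-end (cellAt (inject₁ i)) ≡ false
  isEnd-◁-inject₁ zero    = refl
  isEnd-◁-inject₁ (suc i) = cong (isEnd ◁-end) (lookup-inner (fromList w) i)

  isEnd-▷-suc : ∀ i → isEnd ▷-end (cellAt (suc i)) ≡ false
  isEnd-▷-suc = lookup-not-▷ (fromList w)

module Play {A : Alphabet} (G : Game A) (w : Word A) where
  open Game G
  open InputTape A w

  Position : Set
  Position = Fin (suc (suc (length w)))

  Placement : Set
  Placement = Symbol Heads → Position

  Legal : Control → Placement → Symbol Moves → Set
  Legal s pos m = ∀ h → test s m h (cellAt (pos h)) ≡ true

  moved : Control → Placement → Symbol Moves → Bool → Placement
  moved s pos m b h = applyAction (act s m b h) (pos h)

  -- Both predicates are inductive, so a play that follows one of them is finite. `Lose` considers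
  -- legal moves only, since an illegal one is left to the heads to detect, and it demands that a
  -- legal move never end the game.
  data Win (s : Control) (pos : Placement) : Set where
    win : (m : Symbol Moves) → Legal s pos m →
          (∀ b s′ → next s m b ≡ just s′ → Win s′ (moved s pos m b)) → Win s pos

  data Lose (s : Control) (pos : Placement) : Set where
    lose : (∀ m → Legal s pos m → ∃[ b ] ∃[ s′ ] next s m b ≡ just s′ × Lose s′ (moved s pos m b)) → Lose s pos

  homes : Placement
  homes h = endpoint (home h)

-- The verifier of a game

moveRight-inject₁ : ∀ {n} (i : Fin n) → moveRight (inject₁ i) ≡ suc i
moveRight-inject₁ {suc zero}    zero    = refl
moveRight-inject₁ {suc (suc n)} zero    = refl
moveRight-inject₁ {suc (suc n)} (suc i) = cong suc (moveRight-inject₁ i)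

toward : Bool → Direction
toward ▷-end = left
toward ◁-end = right

module _ {A : Alphabet} (G : Game A) (m : ℕ) where
  open Game G

  private
    K : ℕ
    K = Alphabet.size-1 Heads

    head : Fin (suc K) → Symbol Heads
    head = Inverse.from (Alphabet.finite Heads)

  Phase : Set
  Phase = ⊤ ⊎ Control ⊎ (Control × Symbol Moves) ⊎ (Control × Bool)

  pattern pick        = inj₁ tt
  pattern read s      = inj₂ (inj₁ s)
  pattern listen s μ  = inj₂ (inj₂ (inj₁ (s , μ)))
  pattern walk s e    = inj₂ (inj₂ (inj₂ (s , e)))

  -- The number of rounds still to follow, the head tracked in this round,
  -- and what to do next.
  TrackState : Set
  TrackState = Fin (suc m) × Fin (suc K) × Phase

  endRound : Fin (suc m) → Outcome (TrackState × Direction × DebateMove)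
  -- Acceptance is the default: the verifier rejects only on a failed test or a message out of turn.
  endRound zero    = halt accept
  endRound (suc r) = continue ((inject₁ r , fromℕ K , pick) , stay , advance)

  goHome : Fin (suc m) → Fin (suc K) → Outcome (TrackState × Direction × DebateMove)
  goHome r k = continue ((r , k , walk initial (home (head k))) , stay , stay)

  obey : Fin (suc m) → Fin (suc K) → Control → Action → Outcome (TrackState × Direction × DebateMove)
  obey r k s (move d) = continue ((r , k , read s) , d , advance)
  obey r k s (goto e) = continue ((r , k , walk s e) , stay , advance)

  advanceControl : Fin (suc m) → Fin (suc K) → Action → Maybe Control → Outcome (TrackState × Direction × DebateMove)
  advanceControl r k a nothing  = endRound r
  advanceControl r k a (just s) = obey r k s a

  trackδ : TrackState → InputCell A → Symbol Moves ⊎ Maybe Bool → Step (Outcome (TrackState × Direction × DebateMove))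
  trackδ (r , k     , read s)     c (inj₁ μ)        =
    det (if test s μ (head k) c then continue ((r , k , listen s μ) , stay , advance) else halt reject)
  trackδ (r , k     , read s)     c (inj₂ _)        = det (halt reject)
  trackδ (r , k     , listen s μ) c (inj₁ _)        = det (halt reject)
  -- The refuter calls a stop. The tracked head has passed its test and cannot tell whether another
  -- one failed, so the round ends undecided.
  trackδ (r , k     , listen s μ) c (inj₂ nothing)  = det (endRound r)
  trackδ (r , k     , listen s μ) c (inj₂ (just b)) = det (advanceControl r k (act s μ b (head k)) (next s μ b))
  trackδ (r , k     , walk s e)   c γ               =
    det (if isEnd e c then continue ((r , k , read s) , stay , stay) else continue ((r , k , walk s e) , toward e , stay))
  trackδ (r , zero  , pick)       c γ               = det (goHome r zero)
  -- A chain of coins decides one head per toss and is bounded for all outcomes. A uniform choice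
  -- among `suc K` heads with boundedly many fair coins would require `suc K` to be a power of 2.
  trackδ (r , suc k , pick)       c γ               =
    toss λ { true → goHome r (suc k) ; false → continue ((r , inject₁ k , pick) , stay , stay) }

  verifier : Verifier A
  verifier = record
    { State        = TrackState
    ; state-finite = ×-finite (Fin-finite _) (×-finite (Fin-finite _) (⊎-finite ⊤-finite (⊎-finite control-finite
        (⊎-finite (×-finite control-finite (_ , Alphabet.finite Moves)) (×-finite control-finite Bool-finite)))))
    ; Γ₁           = Moves
    ; Γ₀           = record { Symbol = Maybe Bool ; size-1 = 2 ; finite = Maybe↔ (↔-sym 2↔Bool) }
    ; start        = fromℕ m , fromℕ K , pick
    ; δ            = trackδ
    }

  -- Every toss lowers this potential and no other step raises it. The resulting bound needs nothing
  -- about the course of the debate and so covers strategies that make it endless.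
  coinsLeft : TrackState → ℕ
  coinsLeft (r , k , pick)   = toℕ r ℕ.* suc K ℕ.+ toℕ k
  coinsLeft (r , k , inj₂ _) = toℕ r ℕ.* suc K

-- Bounding the number of coins

module TossBound {A : Alphabet} (V : Verifier A) (budget : Verifier.State V → ℕ) where
  open Verifier V hiding (Prover; Refuter)

  cost : {X : Set} → Outcome (State × X) → ℕ
  cost (halt _)           = 0
  cost (continue (q , _)) = budget q

  Pays : {X : Set} → ℕ → Step (Outcome (State × X)) → Set
  Pays n (det a)  = cost a ℕ.≤ n
  Pays n (toss f) = ∀ b → cost (f b) ℕ.< n

  tosses≤budget : (∀ q c γ → Pays (budget q) (δ q c γ)) →
    ∀ P R w ω t C → Debate.tosses V P R w ω t C ℕ.≤ cost C
  tosses≤budget pays P R w = bounded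
    where
    open Debate V P R w

    cost-perform : ∀ i j a → cost (perform i j a) ≡ cost a
    cost-perform i j (halt _)     = refl
    cost-perform i j (continue _) = refl

    bounded : ∀ ω t C → tosses ω t C ℕ.≤ cost C
    bounded ω zero    C        = z≤n
    bounded ω (suc t) (halt v) = bounded ω t (halt v)
    bounded ω (suc t) (continue (q , i , j)) with δ q (lookup (inputTape w) i) (debate j) | pays q (lookup (inputTape w) i) (debate j)
    ... | det a  | p = ℕ.≤-trans (bounded ω t (perform i j a)) (ℕ.≤-trans (ℕ.≤-reflexive (cost-perform i j a)) p)
    ... | toss f | p = ℕ.≤-trans (s≤s (bounded _ t (perform i j (f (ω 0)))))
                         (ℕ.≤-trans (s≤s (ℕ.≤-reflexive (cost-perform i j (f (ω 0))))) (p (ω 0)))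

verifier-tosses : ∀ {A} (G : Game A) m → ∃[ c ] TossesAtMost (verifier G m) c
verifier-tosses {A} G m = coinsLeft G m (start V) , λ w P R ω t → tosses≤budget pays P R w ω t _
  where
  open Verifier using (start; Γ)
  open Game G
  V = verifier G m
  open TossBound V (coinsLeft G m)
  K = Alphabet.size-1 Heads

  pays-endRound : ∀ r → cost (endRound G m r) ℕ.≤ toℕ r ℕ.* suc K
  pays-endRound zero    = z≤n
  pays-endRound (suc r) = ℕ.≤-trans (ℕ.≤-reflexive (cong₂ (λ x y → x ℕ.* suc K ℕ.+ y) (toℕ-inject₁ r) (toℕ-fromℕ K)))
    (ℕ.≤-trans (ℕ.+-monoʳ-≤ (toℕ r ℕ.* suc K) (ℕ.n≤1+n K)) (ℕ.≤-reflexive (ℕ.+-comm (toℕ r ℕ.* suc K) (suc K))))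

  pays-advance : ∀ r k a s → cost (advanceControl G m r k a s) ℕ.≤ toℕ r ℕ.* suc K
  pays-advance r k a        nothing  = pays-endRound r
  pays-advance r k (move d) (just s) = ℕ.≤-refl
  pays-advance r k (goto e) (just s) = ℕ.≤-refl

  pays : ∀ q c γ → Pays (coinsLeft G m q) (trackδ G m q c γ)
  pays (r , zero  , pick)       c γ               = ℕ.m≤m+n _ 0
  pays (r , suc k , pick)       c γ               true  = ℕ.m<m+n _ (s≤s z≤n)
  pays (r , suc k , pick)       c γ               false =
    ℕ.+-monoʳ-< (toℕ r ℕ.* suc K) (s≤s (ℕ.≤-reflexive (toℕ-inject₁ k)))
  pays (r , k     , read s)     c (inj₁ μ) with test s μ (Inverse.from (Alphabet.finite Heads) k) c
  ... | true  = ℕ.≤-refl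
  ... | false = z≤n
  pays (r , k     , read s)     c (inj₂ _)        = z≤n
  pays (r , k     , listen s μ) c (inj₁ _)        = z≤n
  pays (r , k     , listen s μ) c (inj₂ nothing)  = pays-endRound r
  pays (r , k     , listen s μ) c (inj₂ (just b)) = pays-advance r k _ (next s μ b)
  pays (r , k     , walk s e)   c γ with isEnd e c
  ... | true  = ℕ.≤-refl
  ... | false = ℕ.≤-refl

-- Acceptance and rejection probabilities of the verifier of a game

module _ where
  open import Data.Rational using (_+_; _*_; _-_; _≤_; _<_)

  module Track {A : Alphabet} (G : Game A) (m : ℕ)
               (P : Prover (verifier G m)) (R : Refuter (verifier G m)) (w : Word A) where
    open Game G
    open InputTape A w
    open Play G w
    open Debate (verifier G m) P R w using (Config; perform; debate; prefix)
    open Probability (verifier G m) P R w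

    K : ℕ
    K = Alphabet.size-1 Heads

    head : Fin (suc K) → Symbol Heads
    head = Inverse.from (Alphabet.finite Heads)

    at : TrackState G m → Position → ℕ → Config
    at q i j = continue (q , i , j)

    -- Induction on the distance from the end. Positions decrease on the way to ▷ and increase on
    -- the way to ◁, hence the two induction principles.
    walk-prob : ∀ {v p r k s} e {j} → HaltsWithProb v p (at (r , k , read s) (endpoint e) j) →
      ∀ i → HaltsWithProb v p (at (r , k , walk s e) i j)
    walk-prob {v} {p} {r} {k} {s} e {j} there = go e there
      where
      step : ∀ e b → Step (Outcome (TrackState G m × Direction × DebateMove))
      step e b = det (if b then continue ((r , k , read s) , stay , stay) else continue ((r , k , walk s e) , toward e , stay))
      Walks : Bool → Position → Set
      Walks e i = HaltsWithProb v p (at (r , k , walk s e) i j)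
      go : ∀ e → HaltsWithProb v p (at (r , k , read s) (endpoint e) j) → ∀ i → Walks e i
      go ▷-end there = <-weakInduction (Walks ▷-end) (det-prob refl there)
        (λ i → det-prob (cong (step ▷-end) (isEnd-▷-suc i)))
      go ◁-end there = >-weakInduction (Walks ◁-end) (det-prob (cong (step ◁-end) (isEnd-endpoint ◁-end)) there)
        (λ i rec → det-prob (cong (step ◁-end) (isEnd-◁-inject₁ i)) (subst (Walks ◁-end) (≡-sym (moveRight-inject₁ i)) rec))

    home-prob : ∀ {v p r k i j} → HaltsWithProb v p (at (r , k , read initial) (homes (head k)) j) →
      HaltsWithProb v p (perform i j (goHome G m r k))
    home-prob {k = k} {i} there = walk-prob (home (head k)) there i

    pick-prob : ∀ {v p r j} → (∀ k → HaltsWithProb v p (at (r , k , read initial) (homes (head k)) j)) →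
      ∀ k i → HaltsWithProb v p (at (r , k , pick) i j)
    pick-prob {v} {p} {r} {j} each = <-weakInduction (λ k → ∀ i → HaltsWithProb v p (at (r , k , pick) i j))
      (λ i → det-prob refl (home-prob (each zero)))
      (λ k rec i → subst (λ q → HaltsWithProb v q (at (r , suc k , pick) i j)) (½-mix-idem p)
        (toss-prob refl (home-prob (each (suc k))) (rec i)))

    pick-improves : ∀ {v p r j} → p ≤ 1ℚ → (∀ k → HaltsWithProb v p (at (r , k , read initial) (homes (head k)) j)) →
      ∀ k* → HaltsWithProb v 1ℚ (at (r , k* , read initial) (homes (head k*)) j) →
      ∀ k i → toℕ k* ℕ.≤ toℕ k → HaltsWithProb v (improve (toℕ k) p) (at (r , k , pick) i j)
    pick-improves {v} {p} {r} {j} p≤1 each k* sure = <-weakInduction _ base step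
      where
      base : ∀ i → toℕ k* ℕ.≤ 0 → HaltsWithProb v 1ℚ (at (r , zero , pick) i j)
      base i k*≤0 = det-prob refl (home-prob (subst (λ k → HaltsWithProb v 1ℚ (at (r , k , read initial) (homes (head k)) j))
        (Fin.toℕ-injective (ℕ.n≤0⇒n≡0 k*≤0)) sure))
      step : ∀ k → (∀ i → toℕ k* ℕ.≤ toℕ (inject₁ k) → HaltsWithProb v (improve (toℕ (inject₁ k)) p) (at (r , inject₁ k , pick) i j)) →
        ∀ i → toℕ k* ℕ.≤ suc (toℕ k) → HaltsWithProb v (improve (suc (toℕ k)) p) (at (r , suc k , pick) i j)
      step k rec i k*≤ with ℕ.m≤n⇒m<n∨m≡n k*≤
      ... | inj₁ k*<1+k = toss-prob refl (home-prob (each (suc k)))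
              (subst (λ x → HaltsWithProb v (improve x p) (at (r , inject₁ k , pick) i j)) (toℕ-inject₁ k)
                (rec i (subst (toℕ k* ℕ.≤_) (≡-sym (toℕ-inject₁ k)) (ℕ.s≤s⁻¹ k*<1+k))))
      -- The sure head comes up at this very coin: half of the weight rejects for certain, which is
      -- at least the half of `improve` required.
      ... | inj₂ k*≡1+k with refl ← Fin.toℕ-injective {i = k*} {j = suc k} k*≡1+k =
              weaken (ℚ.≤-trans (ℚ.≤-reflexive (ℚ.+-comm (½ * p) (½ * improve (toℕ k) p))) (½-mix (improve≤1 (toℕ k) p≤1) (ℚ.≤-refl {p})))
                (toss-prob refl (home-prob sure) (pick-prob each (inject₁ k) i))

    module _ {s : Control} {μ : Symbol Moves} {r : Fin (suc m)} {k : Fin (suc K)} {i : Position} {j : ℕ} (heard : debate j ≡ inj₁ μ) where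

      private
        verdict : Bool → Step (Outcome (TrackState G m × Direction × DebateMove))
        verdict b = det (if b then continue ((r , k , listen s μ) , stay , advance) else halt reject)

      failed-test : test s μ (head k) (cellAt i) ≡ false → HaltsWithProb reject 1ℚ (at (r , k , read s) i j)
      failed-test fails = det-prob (trans (cong (trackδ G m (r , k , read s) (cellAt i)) heard) (cong verdict fails)) rejected

      module _ {v : Verdict} {p : ℚ} (passes : test s μ (head k) (cellAt i) ≡ true) where

        private
          passed-test : ∀ {ρ a} → debate (suc j) ≡ inj₂ ρ → trackδ G m (r , k , listen s μ) (cellAt i) (inj₂ ρ) ≡ det a →
            HaltsWithProb v p (perform i (suc j) a) → HaltsWithProb v p (at (r , k , read s) i j)
          passed-test answered eq there =
            det-prob (trans (cong (trackδ G m (r , k , read s) (cellAt i)) heard) (cong verdict passes))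
              (det-prob (trans (cong (trackδ G m (r , k , listen s μ) (cellAt i)) answered) eq) there)

        stopped : debate (suc j) ≡ inj₂ nothing →
          HaltsWithProb v p (perform i (suc j) (endRound G m r)) → HaltsWithProb v p (at (r , k , read s) i j)
        stopped answered = passed-test answered refl

        ended : ∀ {b} → debate (suc j) ≡ inj₂ (just b) → next s μ b ≡ nothing →
          HaltsWithProb v p (perform i (suc j) (endRound G m r)) → HaltsWithProb v p (at (r , k , read s) i j)
        ended {b} answered over = passed-test answered (cong (λ n → det (advanceControl G m r k (act s μ b (head k)) n)) over)

        went-on : ∀ {b s′} → debate (suc j) ≡ inj₂ (just b) → next s μ b ≡ just s′ →
          HaltsWithProb v p (at (r , k , read s′) (applyAction (act s μ b (head k)) i) (suc (suc j))) →
          HaltsWithProb v p (at (r , k , read s) i j)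
        went-on {b} {s′} answered eq there =
          passed-test answered (cong (λ n → det (advanceControl G m r k (act s μ b (head k)) n)) eq) (obeyed (act s μ b (head k)) there)
          where
          obeyed : ∀ a → HaltsWithProb v p (at (r , k , read s′) (applyAction a i) (suc (suc j))) →
            HaltsWithProb v p (perform i (suc j) (obey G m r k s′ a))
          obeyed (move d) there = there
          obeyed (goto e) there = walk-prob e there i

  module Completeness {A : Alphabet} (G : Game A) (m : ℕ) (w : Word A) (W₀ : Play.Win G w (Game.initial G) (Play.homes G w)) where
    open Game G
    open Play G w
    private
      V = verifier G m

    -- The prover's memory. A strategy sees only the history, so this state is recomputed by folding
    -- `update` over the debate. It places all heads, of which the verifier follows one.
    WinningState : Set
    WinningState = Σ[ s ∈ Control ] Σ[ pos ∈ Placement ] Win s pos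

    restart : WinningState
    restart = initial , homes , W₀

    resume : ∀ {pos} (n : Maybe Control) → (∀ s′ → n ≡ just s′ → Win s′ pos) → WinningState
    resume nothing   _ = restart
    resume (just s′) f = s′ , _ , f s′ refl

    resume-nothing : ∀ {pos n} (f : ∀ s′ → n ≡ just s′ → Win s′ pos) → n ≡ nothing → resume n f ≡ restart
    resume-nothing f refl = refl

    resume-just : ∀ {pos n s′} (f : ∀ s′ → n ≡ just s′ → Win s′ pos) (eq : n ≡ just s′) → resume n f ≡ (s′ , pos , f s′ eq)
    resume-just f refl = refl

    update : WinningState → Verifier.Γ V → WinningState
    update st                     (inj₁ _)        = st
    update _                      (inj₂ nothing)  = restart
    update (s , pos , win μ _ f)  (inj₂ (just b)) = resume (next s μ b) (f b)

    bestMove : WinningState → Symbol Moves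
    bestMove (_ , _ , win μ _ _) = μ

    prover : Prover V
    prover _ γs = bestMove (foldl update restart γs)

    module _ (R : Refuter V) where
      open Debate V prover R w using (perform; debate; prefix)
      open Probability V prover R w
      open Track G m prover R w

      state : ℕ → WinningState
      state j = foldl update restart (prefix j)

      RoundAccepted : Fin (suc m) → Set
      RoundAccepted r = ∀ i {j} → parity j ≡ 0ℙ → state (suc (suc j)) ≡ restart →
        HaltsWithProb accept 1ℚ (perform i (suc j) (endRound G m r))

      turn-accepted : ∀ {r} → RoundAccepted r → ∀ {s pos} (W : Win s pos) {j} → parity j ≡ 0ℙ → state j ≡ (s , pos , W) →
        ∀ k → HaltsWithProb accept 1ℚ (at (r , k , read s) (pos (head k)) j)
      turn-accepted {r} over {s} {pos} (win μ legal f) {j} even eq k = answer (R w (prefix (suc j))) (debate-odd {suc j} (parity-suc {j} even))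
        where
        heard : debate j ≡ inj₁ μ
        heard = trans (debate-even {j} even) (cong (inj₁ ∘ bestMove) eq)
        state₁ : state (suc j) ≡ (s , pos , win μ legal f)
        state₁ = trans (foldl-prefix update restart j) (trans (cong (update (state j)) heard) eq)
        state₂ : ∀ {ρ} → debate (suc j) ≡ inj₂ ρ → state (suc (suc j)) ≡ update (s , pos , win μ legal f) (inj₂ ρ)
        state₂ answered = trans (foldl-prefix update restart (suc j)) (cong₂ update state₁ answered)
        Goal = HaltsWithProb accept 1ℚ (at (r , k , read s) (pos (head k)) j)
        answer : ∀ ρ → debate (suc j) ≡ inj₂ ρ → Goal
        answer nothing  answered = stopped heard (legal (head k)) answered (over _ {j} even (state₂ answered))
        answer (just b) answered = go-on (next s μ b) refl
          where
          go-on : ∀ n → next s μ b ≡ n → Goal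
          go-on nothing   next≡ = ended heard (legal (head k)) answered next≡
            (over _ {j} even (trans (state₂ answered) (resume-nothing (f b) next≡)))
          go-on (just s′) next≡ = went-on heard (legal (head k)) answered next≡
            (turn-accepted over (f b s′ next≡) {suc (suc j)} even (trans (state₂ answered) (resume-just (f b) next≡)) k)

      round-accepted : ∀ r → RoundAccepted r
      round-accepted = <-weakInduction RoundAccepted (λ _ _ _ → accepted)
        (λ r rec i even eq → pick-prob (turn-accepted rec W₀ even eq) (fromℕ K) i)

      run-accepted : HaltsWithProb accept 1ℚ (Debate.initial V prover R w)
      run-accepted = pick-prob (turn-accepted (round-accepted (fromℕ m)) W₀ refl refl) (fromℕ K) zero

      acceptance : acc V prover R w ≈ fromℚ 1ℚ
      acceptance = (λ (t , q<) → ℚ.<-≤-trans q< (haltsWithin≤1 accept t _))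
                 , (λ q<1 → proj₁ run-accepted , ℚ.<-≤-trans q<1 (proj₂ run-accepted))

  module Soundness {A : Alphabet} (G : Game A) (m : ℕ) (w : Word A) (L₀ : Play.Lose G w (Game.initial G) (Play.homes G w)) where
    open Game G
    open InputTape A w
    open Play G w
    private
      V = verifier G m

    LosingState : Set
    LosingState = Σ[ s ∈ Control ] Σ[ pos ∈ Placement ] Lose s pos

    restart : LosingState
    restart = initial , homes , L₀

    passes? : ∀ s (pos : Placement) μ h → Dec (test s μ h (cellAt (pos h)) ≡ true)
    passes? s pos μ h = test s μ h (cellAt (pos h)) Bool.≟ true

    private
      K = Alphabet.size-1 Heads
      head : Fin (suc K) → Symbol Heads
      head = Inverse.from (Alphabet.finite Heads)

    onAllHeads : ∀ {Q : Symbol Heads → Set} → (∀ k → Q (head k)) → ∀ h → Q h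
    onAllHeads {Q} all h = subst Q (Inverse.strictlyInverseʳ (Alphabet.finite Heads) h) (all (Inverse.to (Alphabet.finite Heads) h))

    legal? : ∀ s pos μ → Dec (Legal s pos μ)
    legal? s pos μ = map′ onAllHeads (λ legal k → legal (head k)) (all? (λ k → passes? s pos μ (head k)))

    failingHead : ∀ {s pos μ} → ¬ Legal s pos μ → ∃[ k ] test s μ (head k) (cellAt (pos (head k))) ≡ false
    failingHead {s} {pos} {μ} illegal with ¬∀⟶∃¬ (suc K) _ (λ k → passes? s pos μ (head k)) (λ all → illegal (onAllHeads all))
    ... | k , fails = k , Bool.¬-not fails

    -- Tests are Boolean and heads finitely many, so the refuter can decide legality; the losing
    -- proof itself supplies the bit against a legal move.
    respond : LosingState → Symbol Moves → Maybe Bool × LosingState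
    respond (s , pos , lose f) μ with legal? s pos μ
    ... | no _      = nothing , restart
    ... | yes legal with b , s′ , _ , ℓ ← f μ legal = just b , s′ , _ , ℓ

    -- The answer is computed when the prover's move is folded in and is stored as the first
    -- component until the refuter speaks.
    update : Maybe Bool × LosingState → Verifier.Γ V → Maybe Bool × LosingState
    update (_ , st) (inj₁ μ) = respond st μ
    update st       (inj₂ _) = st

    refuter : Refuter V
    refuter _ γs = proj₁ (foldl update (nothing , restart) γs)

    module _ (P : Prover V) where
      open Debate V P refuter w using (perform; debate; prefix)
      open Probability V P refuter w
      open Track G m P refuter w hiding (K; head)

      state : ℕ → Maybe Bool × LosingState
      state j = foldl update (nothing , restart) (prefix j)

      RoundRejects : ℚ → Fin (suc m) → Set
      RoundRejects p r = ∀ i {j} → parity j ≡ 0ℙ → proj₂ (state (suc (suc j))) ≡ restart →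
        HaltsWithProb reject p (perform i (suc j) (endRound G m r))

      -- As `Lose` is inductive, the play reaches an illegal move, and a head that fails it is the
      -- sure one. Any other head fails there too or is released into the next round by the stop,
      -- which accounts for `p`.
      turn-rejects : ∀ {p r} → p ≤ 1ℚ → RoundRejects p r →
        ∀ {s pos} (ℓ : Lose s pos) {j} → parity j ≡ 0ℙ → proj₂ (state j) ≡ (s , pos , ℓ) →
        (∀ k → HaltsWithProb reject p (at (r , k , read s) (pos (head k)) j))
        × ∃[ k ] HaltsWithProb reject 1ℚ (at (r , k , read s) (pos (head k)) j)
      turn-rejects {p} {r} p≤1 over {s} {pos} (lose f) {j} even eq = result
        where
        μ = P w (prefix j)
        heard : debate j ≡ inj₁ μ
        heard = debate-even {j} even
        state₁ : state (suc j) ≡ respond (s , pos , lose f) μ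
        state₁ = trans (foldl-prefix update (nothing , restart) j)
          (trans (cong (update (state j)) heard) (cong (λ st → respond st μ) eq))
        answered : debate (suc j) ≡ inj₂ (proj₁ (respond (s , pos , lose f) μ))
        answered = trans (debate-odd {suc j} (parity-suc {j} even)) (cong (inj₂ ∘ proj₁) state₁)
        state₂ : proj₂ (state (suc (suc j))) ≡ proj₂ (respond (s , pos , lose f) μ)
        state₂ = cong proj₂ (trans (foldl-prefix update (nothing , restart) (suc j)) (trans (cong (update (state (suc j))) answered) state₁))
        result : (∀ k → HaltsWithProb reject p (at (r , k , read s) (pos (head k)) j))
               × ∃[ k ] HaltsWithProb reject 1ℚ (at (r , k , read s) (pos (head k)) j)
        result with legal? s pos μ | answered | state₂
        ... | no illegal | answered | state₂ = each , proj₁ caught , failed-test heard (proj₂ caught)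
          where
          caught = failingHead {s} {pos} {μ} illegal
          each : ∀ k → HaltsWithProb reject p (at (r , k , read s) (pos (head k)) j)
          each k with test s μ (head k) (cellAt (pos (head k))) in tested
          ... | true  = stopped heard tested answered (over (pos (head k)) {j} even state₂)
          ... | false = weaken p≤1 (failed-test heard tested)
        ... | yes legal | answered | state₂ with f μ legal
        ... | b , s′ , next≡ , ℓ with turn-rejects p≤1 over ℓ {suc (suc j)} even state₂
        ... | each , k* , sure = (λ k → went-on heard (legal (head k)) answered next≡ (each k))
                               , k* , went-on heard (legal (head k*)) answered next≡ sure

      start-rejects : ∀ r → RoundRejects (bound K (toℕ r)) r → ∀ i {j} → parity j ≡ 0ℙ → proj₂ (state j) ≡ restart →
        HaltsWithProb reject (bound K (suc (toℕ r))) (at (r , fromℕ K , pick) i j)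
      start-rejects r rec i even eq with turn-rejects (bound≤1 K (toℕ r)) rec L₀ even eq
      ... | each , k* , sure = subst (λ x → HaltsWithProb reject (improve x (bound K (toℕ r))) (at (r , fromℕ K , pick) i _)) (toℕ-fromℕ K)
        (pick-improves (bound≤1 K (toℕ r)) each k* sure (fromℕ K) i (≤fromℕ k*))

      round-rejects : ∀ r → RoundRejects (bound K (toℕ r)) r
      round-rejects = <-weakInduction (λ r → RoundRejects (bound K (toℕ r)) r) (λ _ _ _ → 0-prob)
        (λ r rec i {j} even eq → subst (λ x → HaltsWithProb reject (bound K (suc x)) (at (inject₁ r , fromℕ K , pick) i (suc (suc j))))
          (toℕ-inject₁ r) (start-rejects (inject₁ r) rec i {suc (suc j)} even eq))

      run-rejects : HaltsWithProb reject (bound K (suc m)) (Debate.initial V P refuter w)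
      run-rejects = subst (λ x → HaltsWithProb reject (bound K (suc x)) (Debate.initial V P refuter w)) (toℕ-fromℕ m)
        (start-rejects (fromℕ m) (round-rejects (fromℕ m)) zero refl refl)

  -- Choosing the number of rounds for a given error

  1-cancel-< : ∀ p q → 1ℚ - p < 1ℚ - q → q < p
  1-cancel-< p q 1-p<1-q = subst₂ _<_
    (solve 2 (λ q p → (con 1ℚ :- p) :+ (q :+ p :- con 1ℚ) := q) refl q p)
    (solve 2 (λ q p → (con 1ℚ :- q) :+ (q :+ p :- con 1ℚ) := p) refl q p)
    (ℚ.+-monoˡ-< (q + p - 1ℚ) 1-p<1-q)
    where open ℚ-Solver.+-*-Solver

  Verifiable : (A : Alphabet) → Language A → ℝ → Set₁
  Verifiable A L ε = Σ[ V ∈ Verifier A ] Σ[ c ∈ ℕ ]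
    (TossesAtMost V c
     × (∀ w → L w → Σ[ P ∈ Prover V ] (∀ (R : Refuter V) → acc V P R w ≈ fromℚ 1ℚ))
     × (∀ w → ¬ L w → ∀ (P : Prover V) → Σ[ R ∈ Refuter V ] rej V P R w ≥ (1- ε)))

  module _ {A : Alphabet} (L : Language A) (G : Game A) where
    open Game G

    private
      K = Alphabet.size-1 Heads

    rej≥1-ε : ∀ {ε r m} → ℝ.lower ε r → 1ℚ - bound K m ≤ r →
      ∀ w (ℓ : Play.Lose G w initial (Play.homes G w)) P → rej (verifier G m) P (Soundness.refuter G m w ℓ) w ≥ (1- ε)
    rej≥1-ε {ε} {r} {m} r<ε 1-b≤r w ℓ P {q} ε<1-q = proj₁ rejects , ℚ.<-≤-trans q<bound (proj₂ rejects)
      where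
      rejects = Soundness.run-rejects G m w ℓ P
      q<bound : q < bound K (suc m)
      -- `verifier G m` plays `suc m` rounds, one more than the error requires; `p≤improve` absorbs
      -- the surplus.
      q<bound = ℚ.<-≤-trans
        (1-cancel-< (bound K m) q (ℚ.≤-<-trans 1-b≤r (lower<upper ε r<ε ε<1-q))) (p≤improve K (bound≤1 K m))

    game⇒verifiable : (∀ w → L w → Play.Win G w initial (Play.homes G w)) →
      (∀ w → ¬ L w → Play.Lose G w initial (Play.homes G w)) → ∀ ε → Positive ε → Verifiable A L ε
    -- Roundedness yields a positive rational below `ε`, and only this rational enters the choice of
    -- the number of rounds.
    game⇒verifiable wins loses ε ε>0 = rounds (Equivalence.to (ℝ.lower-rounded ε 0ℚ) ε>0)
      where
      enough : ∀ {r} → ℝ.lower ε r → (∃[ m ] 1ℚ - bound K m ≤ r) → Verifiable A L ε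
      enough r<ε (m , 1-b≤r) = verifier G m , proj₁ (verifier-tosses G m) , proj₂ (verifier-tosses G m)
        , (λ w w∈L → Completeness.prover G m w (wins w w∈L) , Completeness.acceptance G m w (wins w w∈L))
        , (λ w w∉L P → Soundness.refuter G m w (loses w w∉L) , rej≥1-ε {ε} {m = m} r<ε 1-b≤r w (loses w w∉L) P)
      rounds : (∃[ r ] 0ℚ < r × ℝ.lower ε r) → Verifiable A L ε
      rounds (r , 0<r , r<ε) = enough r<ε (bound-tends-to-1 K r 0<r)

open import Data.Nat using (_+_; _*_; _^_; _<_; _≤_)

-- Counters with one digit per head

record Instruction (A : Alphabet) (D : ℕ) : Set where
  field
    passes : Fin D → InputCell A → Bool
    does   : Fin D → Action

open Instruction

-- Adding (e = ◁) or subtracting (e = ▷) one when j is the digit at which the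
-- carry or borrow stops: the digits below j must be at the end e and jump to
-- the other end.
shiftTest : ∀ {A D} → Bool → Fin D → Fin D → InputCell A → Bool
shiftTest e zero    zero    c = not (isEnd e c)
shiftTest e zero    (suc d) c = true
shiftTest e (suc j) zero    c = isEnd e c
shiftTest e (suc j) (suc d) c = shiftTest e j d c

shiftAction : ∀ {D} → Bool → Fin D → Fin D → Action
shiftAction e zero    zero    = move (toward e)
shiftAction e zero    (suc d) = move stay
shiftAction e (suc j) zero    = goto (not e)
shiftAction e (suc j) (suc d) = shiftAction e j d

module _ {A : Alphabet} {D : ℕ} where

  check : (Fin D → InputCell A → Bool) → Instruction A D
  check t = record { passes = t ; does = λ _ → move stay }

  keep fail ifZero clear : Instruction A D
  keep   = check λ _ _ → true
  fail   = check λ _ _ → false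
  ifZero = check λ _ → isEnd ▷-end
  clear  = record { passes = λ _ _ → true ; does = λ _ → goto ▷-end }

  shift : Bool → Fin D → Instruction A D
  shift e j = record { passes = shiftTest e j ; does = shiftAction e j }

module Counter (A : Alphabet) (w : Word A) where
  open InputTape A w

  N : ℕ
  N = suc (suc (length w))

  value : ∀ {D} → (Fin D → Fin N) → ℕ
  value {zero}  p = 0
  value {suc D} p = toℕ (p zero) + N * value (p ∘ suc)

  Passes : ∀ {D} → Instruction A D → (Fin D → Fin N) → Set
  Passes I p = ∀ d → passes I d (cellAt (p d)) ≡ true

  result : ∀ {D} → Instruction A D → (Fin D → Fin N) → Fin D → Fin N
  result I p d = applyAction (does I d) (p d)

  value-cong : ∀ {D} {p p′ : Fin D → Fin N} → (∀ d → p d ≡ p′ d) → value p ≡ value p′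
  value-cong {zero}  eq = refl
  value-cong {suc D} eq = cong₂ (λ x y → toℕ x + N * y) (eq zero) (value-cong (eq ∘ suc))

  value-▷ : ∀ D → value {D} (λ _ → zero) ≡ 0
  value-▷ zero    = refl
  value-▷ (suc D) = trans (cong (N *_) (value-▷ D)) (ℕ.*-zeroʳ N)

  -- The largest number with `D` digits, which is where the clock starts.
  value-◁ : ∀ D → suc (value {D} (λ _ → endpoint ◁-end)) ≡ N ^ D
  value-◁ zero    = refl
  value-◁ (suc D) = trans (cong (λ x → suc (x + N * value {D} (λ _ → endpoint ◁-end))) (toℕ-fromℕ (suc (length w))))
    (trans (≡-sym (ℕ.*-suc N (value {D} (λ _ → endpoint ◁-end)))) (cong (N *_) (value-◁ D)))

  at-▷ : ∀ i → isEnd ▷-end (cellAt i) ≡ true → i ≡ zero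
  at-▷ zero    _   = refl
  at-▷ (suc i) at▷ = contradiction (trans (≡-sym at▷) (isEnd-▷-suc i)) λ ()

  at-end : ∀ e i → isEnd e (cellAt i) ≡ true → i ≡ endpoint e
  at-end ▷-end i at▷ = at-▷ i at▷
  at-end ◁-end i at◁ with view i
  ... | ‵fromℕ     = refl
  ... | ‵inject₁ i = contradiction (trans (≡-sym at◁) (isEnd-◁-inject₁ i)) λ ()

  Successor : Bool → ℕ → ℕ → Set
  Successor ▷-end x y = x ≡ suc y
  Successor ◁-end x y = suc x ≡ y

  not-at-end : ∀ e i → not (isEnd e (cellAt i)) ≡ true → Successor e (toℕ i) (toℕ (moveInput (toward e) i))
  not-at-end ▷-end (suc i) _   = cong suc (≡-sym (toℕ-inject₁ i))
  not-at-end ◁-end i       not◁ with view i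
  ... | ‵fromℕ     = contradiction (trans (≡-sym not◁) (cong not (isEnd-endpoint ◁-end))) λ ()
  ... | ‵inject₁ i = trans (cong suc (toℕ-inject₁ i)) (cong toℕ (≡-sym (moveRight-inject₁ i)))

  carry : ∀ e {x y} → Successor e x y → Successor e (toℕ (endpoint {suc (length w)} e) + N * x) (toℕ (endpoint {suc (length w)} (not e)) + N * y)
  carry ▷-end {y = y} refl = trans (ℕ.*-suc N y) (cong (λ z → suc (z + N * y)) (≡-sym (toℕ-fromℕ (suc (length w)))))
  carry ◁-end {x} refl     = trans (cong (λ z → suc (z + N * x)) (toℕ-fromℕ (suc (length w)))) (≡-sym (ℕ.*-suc N x))

  Successor-+ : ∀ e {x y} z → Successor e x y → Successor e (x + z) (y + z)
  Successor-+ ▷-end z refl = refl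
  Successor-+ ◁-end z refl = refl

  -- The tests rule out wraparound: the digit at which the carry or borrow stops is not at the end
  -- `e`. So the neighbour is exact, not modulo `N ^ D`.
  shift-sound : ∀ {D} e j (p : Fin D → Fin N) → Passes (shift e j) p → Successor e (value p) (value (result (shift e j) p))
  shift-sound e zero    p ok = Successor-+ e (N * value (p ∘ suc)) (not-at-end e (p zero) (ok zero))
  shift-sound e (suc j) p ok = subst (λ i → Successor e (toℕ i + N * value (p ∘ suc)) (value (result (shift e (suc j)) p)))
    (≡-sym (at-end e (p zero) (ok zero)))
    (carry e (shift-sound e j (p ∘ suc) (ok ∘ suc)))

  Passes-zero : ∀ {D} e (p : Fin (suc D) → Fin N) → isEnd e (cellAt (p zero)) ≡ false → Passes (shift e zero) p
  Passes-zero e p off zero    = cong not off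
  Passes-zero e p off (suc d) = refl

  Passes-suc : ∀ {D} e j (p : Fin (suc D) → Fin N) → isEnd e (cellAt (p zero)) ≡ true → Passes (shift e j) (p ∘ suc) →
    Passes (shift e (suc j)) p
  Passes-suc e j p on ok zero    = on
  Passes-suc e j p on ok (suc d) = ok d

  dec-complete : ∀ {D} (p : Fin D → Fin N) → value p ≢ 0 → ∃[ j ] Passes (shift ▷-end j) p
  dec-complete {zero}  p ≢0 = contradiction refl ≢0
  dec-complete {suc D} p ≢0 with p zero in p₀
  ... | suc i = zero , Passes-zero ▷-end p (trans (cong (isEnd ▷-end ∘ cellAt) p₀) (isEnd-▷-suc i))
  ... | zero with j , ok ← dec-complete (p ∘ suc) (λ v≡0 → ≢0 (trans (cong (N *_) v≡0) (ℕ.*-zeroʳ N))) =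
    suc j , Passes-suc ▷-end j p (cong (isEnd ▷-end ∘ cellAt) p₀) ok

  -- The carry stops at the lowest digit that is not at ◁, and there is one as long as the successor
  -- fits into `D` digits.
  inc-complete : ∀ {D} (p : Fin D → Fin N) → suc (value p) < N ^ D → ∃[ j ] Passes (shift ◁-end j) p
  inc-complete {zero}  p (s≤s ())
  inc-complete {suc D} p v<max with p zero in p₀
  ... | i with view i
  ... | ‵inject₁ i′ = zero , Passes-zero ◁-end p (trans (cong (isEnd ◁-end ∘ cellAt) p₀) (isEnd-◁-inject₁ i′))
  ... | ‵fromℕ with j , ok ← inc-complete (p ∘ suc) (ℕ.*-cancelˡ-< N _ _ (subst (_< N * N ^ D)
                   (carry ◁-end {value (p ∘ suc)} refl) v<max)) =
    suc j , Passes-suc ◁-end j p (trans (cong (isEnd ◁-end ∘ cellAt) p₀) (isEnd-endpoint ◁-end)) ok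

  ifZero-sound : ∀ {D} (p : Fin D → Fin N) → Passes ifZero p → value p ≡ 0
  ifZero-sound {D} p ok = trans (value-cong (λ d → at-▷ (p d) (ok d))) (value-▷ D)

  ifZero-complete : ∀ {D} (p : Fin D → Fin N) → value p ≡ 0 → Passes ifZero p
  ifZero-complete p v≡0 zero    = cong (isEnd ▷-end ∘ cellAt) (Fin.toℕ-injective {i = p zero} {j = zero} (ℕ.m+n≡0⇒m≡0 (toℕ (p zero)) v≡0))
  ifZero-complete p v≡0 (suc d) = ifZero-complete (p ∘ suc)
    (ℕ.m*n≡0⇒m≡0 _ N (trans (ℕ.*-comm (value (p ∘ suc)) N) (ℕ.m+n≡0⇒n≡0 (toℕ (p zero)) v≡0))) d

Direction-finite : Finite Direction
Direction-finite = 3 , mk↔ₛ′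
  (λ { left → zero ; stay → suc zero ; right → suc (suc zero) })
  (λ { zero → left ; (suc zero) → stay ; (suc (suc zero)) → right })
  (λ { zero → refl ; (suc zero) → refl ; (suc (suc zero)) → refl })
  (λ { left → refl ; stay → refl ; right → refl })

finite⇒≟ : ∀ {X : Set} → Finite X → DecidableEquality X
finite⇒≟ (_ , f) = Fin.inj⇒≟ (↔⇒↣ f)

true⇒ : ∀ {X : Set} (X? : Dec X) → does X? ≡ true → X
true⇒ (yes x) _ = x

-- Machines whose tape is addressed relative to the head

data Address : Set where
  scanned        : Address
  onLeft onRight : ℕ → Address

address : Direction → ℕ → Address
address left  i = onLeft i
address stay  i = scanned
address right i = onRight i

-- The address that a cell had before the head moved; nothing for the cell
-- that was scanned, and hence overwritten, then.
origin : Direction → Address → Maybe Address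
origin left  scanned           = just (onLeft 0)
origin left  (onLeft i)        = just (onLeft (suc i))
origin left  (onRight zero)    = nothing
origin left  (onRight (suc i)) = just (onRight i)
origin stay  scanned           = nothing
origin stay  (onLeft i)        = just (onLeft i)
origin stay  (onRight i)       = just (onRight i)
origin right scanned           = just (onRight 0)
origin right (onLeft zero)     = nothing
origin right (onLeft (suc i))  = just (onLeft i)
origin right (onRight i)       = just (onRight (suc i))

-- The machine starts on a blank cell with the input and its endmarkers, as
-- translated by embed, to the right of the head, so that onRight i is
-- position i of the verifier's input tape.
record Machine (A : Alphabet) : Set₁ where
  field
    State Content  : Set
    state-finite   : Finite State
    content-finite : Finite Content
    start          : State
    blank          : Content
    embed          : InputCell A → Content
    δ              : State → Content → Outcome (State × Content × Direction)

module Run {A : Alphabet} (M : Machine A) (w : Word A) where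
  open Machine M
  open InputTape A w

  N : ℕ
  N = suc (suc (length w))

  Tape : Set
  Tape = Address → Content

  Config : Set
  Config = Outcome (State × Tape)

  inputContent : ∀ {i} → Dec (i < N) → Content
  inputContent (yes i<N) = embed (cellAt (fromℕ< i<N))
  inputContent (no _)    = blank

  initialTape : Tape
  initialTape scanned     = blank
  initialTape (onLeft _)  = blank
  initialTape (onRight i) = inputContent (i ℕ.<? N)

  initialTape-input : ∀ i → initialTape (onRight (toℕ i)) ≡ embed (cellAt i)
  initialTape-input i with toℕ i ℕ.<? N
  ... | yes i<N = cong (embed ∘ cellAt) (Fin.fromℕ<-toℕ i i<N)
  ... | no  i≮N = contradiction (toℕ<n i) i≮N

  initialTape-beyond : ∀ {i} → N ≤ i → initialTape (onRight i) ≡ blank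
  initialTape-beyond {i} N≤i with i ℕ.<? N
  ... | yes i<N = contradiction N≤i (ℕ.<⇒≱ i<N)
  ... | no  _   = refl

  enact : Tape → Outcome (State × Content × Direction) → Config
  enact f (halt v)               = halt v
  enact f (continue (q , y , d)) = continue (q , λ a → maybe′ f y (origin d a))

  step : Config → Config
  step (halt v)           = halt v
  step (continue (q , f)) = enact f (δ q (f scanned))

  run : ℕ → Config
  run zero    = continue (start , initialTape)
  run (suc t) = step (run t)

  -- No claim holds once the machine has halted; acceptance is therefore expressed through the last
  -- running configuration, in `AcceptsAt`.
  Holds : Config → State → Address → Content → Set
  Holds (halt _)            q a x = ⊥
  Holds (continue (q′ , f)) q a x = q′ ≡ q × f a ≡ x

  holds? : ∀ C q a x → Dec (Holds C q a x)
  holds? (halt _)            q a x = no λ ()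
  holds? (continue (q′ , f)) q a x = finite⇒≟ state-finite q′ q ×-dec finite⇒≟ content-finite (f a) x

  Inherited : Config → State → Content → Content → Maybe Address → Set
  Inherited C q x y nothing  = y ≡ x
  Inherited C q x y (just a) = Holds C q a x

  -- Locality of a machine step. The refuter uses this direction contrapositively; `holds-unstep`
  -- supplies the honest prover's move.
  holds-step : ∀ C {q q′ x y y′ d a} → Holds C q′ scanned y → δ q′ y ≡ continue (q , y′ , d) →
    Inherited C q′ x y′ (origin d a) → Holds (step C) q a x
  holds-step (continue (q′ , f)) {x = x} {y′ = y′} {d} {a} (refl , refl) eq inh rewrite eq = refl , inherited (origin d a) inh
    where
    inherited : ∀ o → Inherited (continue (q′ , f)) q′ x y′ o → maybe′ f y′ o ≡ x
    inherited nothing  y′≡x       = y′≡x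
    inherited (just a) (_ , fa≡x) = fa≡x

  holds-unstep : ∀ C {q a x} → Holds (step C) q a x →
    ∃[ q′ ] ∃[ y ] ∃[ y′ ] ∃[ d ] Holds C q′ scanned y × δ q′ y ≡ continue (q , y′ , d) × Inherited C q′ x y′ (origin d a)
  holds-unstep (continue (q′ , f)) {q} {a} {x} h with δ q′ (f scanned) in eq
  ... | continue (_ , y′ , d) with refl , fa≡x ← h = q′ , f scanned , y′ , d , (refl , refl) , eq , inherited (origin d a) fa≡x
    where
    inherited : ∀ o → maybe′ f y′ o ≡ x → Inherited (continue (q′ , f)) q′ x y′ o
    inherited nothing  y′≡x = y′≡x
    inherited (just a) fa≡x = refl , fa≡x

  AcceptsAt : ℕ → Set
  AcceptsAt t = ∃[ q ] ∃[ y ] Holds (run t) q scanned y × δ q y ≡ halt accept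

  accepting-step : ∀ {t} → AcceptsAt t → run (suc t) ≡ halt accept
  accepting-step {t} (q , y , scans , δ≡) with run t
  ... | continue (_ , f) with refl , refl ← scans = cong (enact f) δ≡

  accepted⇒AcceptsAt : ∀ t → run t ≡ halt accept → ∃[ t′ ] t′ < t × AcceptsAt t′
  accepted⇒AcceptsAt (suc t) eq with run t in run≡
  ... | halt _ with t′ , t′<t , accepts ← accepted⇒AcceptsAt t (trans run≡ eq) = t′ , ℕ.m<n⇒m<1+n t′<t , accepts
  ... | continue (q , f) with δ q (f scanned) in δ≡
  ... | halt _ with refl ← eq = t , ℕ.n<1+n t , q , f scanned , subst (λ C → Holds C q scanned (f scanned)) (≡-sym run≡) (refl , refl) , δ≡

  halt-persists : ∀ {v t} s → run t ≡ halt v → run (s + t) ≡ halt v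
  halt-persists zero    eq = eq
  halt-persists (suc s) eq = cong step (halt-persists s eq)

  -- Verdicts persist, so at time `t + suc t′` the run would show both of them.
  rejected⇒¬AcceptsAt : ∀ {t} → run t ≡ halt reject → ∀ t′ → ¬ AcceptsAt t′
  rejected⇒¬AcceptsAt {t} rejects t′ accepts = contradiction
    (trans (≡-sym (halt-persists t (accepting-step {t′} accepts)))
      (trans (cong run (ℕ.+-comm t (suc t′))) (halt-persists (suc t′) rejects))) λ ()

-- The game on claims about the history of a machine

module _ {A : Alphabet} (M : Machine A) (D′ : ℕ) where
  open Machine M

  private
    D = suc D′
    _≟S_ = finite⇒≟ state-finite
    _≟C_ = finite⇒≟ content-finite

  Claim : Set
  Claim = Maybe (State × Direction × Content)

  -- await: the machine accepts before the time shown by the clock;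
  -- claim q a x: at that time the state is q and the content of the cell with
  -- address a (and the distance shown by the index counter) is x.
  pattern await       = nothing
  pattern claim q a x = just (q , a , x)

  ClaimMove : Set
  ClaimMove = Maybe (Fin D′) ⊎ (Fin D × Maybe (State × Content × Maybe (Fin D)))

  -- base z: the clock shows 0;  later j: it does not accept in the last step;
  -- before j q y z: one step earlier the state was q and the scanned symbol y.
  -- The digits j and z are those at which a carry or borrow stops; z = nothing
  -- asserts that the index is 0 (in before) or on the input tape (in base).
  pattern base z         = inj₁ z
  pattern later j        = inj₂ (j , nothing)
  pattern before j q y z = inj₂ (j , just (q , y , z))

  -- The refuter doubts the claim on the scanned symbol or the remaining one.
  record Plan : Set where
    constructor plan
    field
      clock index         : Instruction A D
      onScanned onCell    : Maybe Claim

  failing : Plan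
  failing = plan fail keep nothing nothing

  guard : {X : Set} → Dec X → Plan → Plan
  guard (yes _) p = p
  guard (no _)  p = failing

  -- `origin` in terms of counters, for the machine's move and the side of the claimed cell. After a
  -- move away from the cell, index 0 means that it was the scanned one; after a move towards its
  -- side, the origin lies one further out and the carry digit must be named, so `nothing` fails.
  inherit : Direction → Direction → Maybe (Fin D) → Instruction A D × Maybe Direction
  inherit stay  stay  _        = keep , nothing
  inherit stay  left  _        = keep , just left
  inherit stay  right _        = keep , just right
  inherit left  stay  _        = clear , just left
  inherit right stay  _        = clear , just right
  inherit left  left  nothing  = fail , nothing
  inherit left  left  (just j) = shift ◁-end j , just left
  inherit left  right nothing  = ifZero , nothing
  inherit left  right (just j) = shift ▷-end j , just right
  inherit right left  nothing  = ifZero , nothing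
  inherit right left  (just j) = shift ▷-end j , just left
  inherit right right nothing  = fail , nothing
  inherit right right (just j) = shift ◁-end j , just right

  -- Once the upper digits are 0, the index equals the position of the lowest digit's head, which
  -- thus scans the very cell that the claim is about.
  inputTest : Content → Fin D → InputCell A → Bool
  inputTest x zero    c = does (embed c ≟C x)
  inputTest x (suc d) c = isEnd ▷-end c

  -- An index lies beyond the input tape exactly if its upper digits are not all 0. The digit at
  -- which a borrow from them would stop witnesses this; nothing is subtracted.
  beyondTest : Content → Fin D′ → Fin D → InputCell A → Bool
  beyondTest x j zero    c = does (blank ≟C x)
  beyondTest x j (suc d) c = shiftTest ▷-end j d c

  initialCheck : Direction → Content → Maybe (Fin D′) → Instruction A D
  initialCheck left  x _        = check λ _ _ → does (blank ≟C x)
  initialCheck stay  x _        = check λ _ _ → does (blank ≟C x)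
  initialCheck right x nothing  = check (inputTest x)
  initialCheck right x (just j) = check (beyondTest x j)

  planOrigin : {X : Set} → Fin D → State → Content → Content → Instruction A D × Maybe Direction → Dec X → Plan
  planOrigin j q y x (I , nothing) y′≟x = guard y′≟x (plan (shift ▷-end j) I (just (claim q stay y)) nothing)
  planOrigin j q y x (I , just a)  _    = plan (shift ▷-end j) I (just (claim q stay y)) (just (claim q a x))

  planBefore : Fin D → State → Content → Maybe (Fin D) → State → Direction → Content → Outcome (State × Content × Direction) → Plan
  planBefore j q′ y z q a x (halt _)                  = failing
  planBefore j q′ y z q a x (continue (q₁ , y′ , d)) = guard (q₁ ≟S q) (planOrigin j q′ y x (inherit d a z) (y′ ≟C x))

  planAccept : Fin D → State → Content → Outcome (State × Content × Direction) → Plan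
  planAccept j q y (halt accept) = plan (shift ▷-end j) keep (just (claim q stay y)) nothing
  planAccept j q y (halt reject) = failing
  planAccept j q y (continue _)  = failing

  planFor : Claim → ClaimMove → Plan
  planFor await         (base _)           = failing
  planFor await         (later j)          = plan (shift ▷-end j) keep (just await) nothing
  planFor await         (before j q y _)   = planAccept j q y (δ q y)
  planFor (claim q a x) (base z)           = guard (start ≟S q) (plan ifZero (initialCheck a x z) nothing nothing)
  planFor (claim q a x) (later _)          = failing
  planFor (claim q a x) (before j q′ y z)  = planBefore j q′ y z q a x (δ q′ y)

  Head : Set
  Head = Bool × Fin D

  pattern clockHead d = true , d
  pattern indexHead d = false , d

  planTest : Plan → Head → InputCell A → Bool
  planTest p (clockHead d) = Instruction.passes (Plan.clock p) d
  planTest p (indexHead d) = Instruction.passes (Plan.index p) d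

  planNext : Plan → Bool → Maybe Claim
  planNext p true  = Plan.onScanned p
  planNext p false = Plan.onCell p

  planAct : Plan → Bool → Head → Action
  planAct p b     (clockHead d) = Instruction.does (Plan.clock p) d
  planAct p true  (indexHead d) = goto ▷-end
  planAct p false (indexHead d) = Instruction.does (Plan.index p) d

  claimGame : Game A
  claimGame = record
    { Control        = Claim
    ; control-finite = Maybe-finite (×-finite state-finite (×-finite Direction-finite content-finite))
    ; Moves          = record { Symbol = ClaimMove ; size-1 = _ ; finite = proj₂ (⊎-finite (Maybe-finite (Fin-finite D′))
        (×-finite (Fin-finite D) (Maybe-finite (×-finite state-finite (×-finite content-finite (Maybe-finite (Fin-finite D))))))) }
    ; Heads          = record { Symbol = Head ; size-1 = _ ; finite = proj₂ (×-finite Bool-finite (Fin-finite D)) }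
    ; initial        = await
    -- The tag of a head is also its home end: clock heads start at ◁, for the largest value, and
    -- index heads at ▷, for 0.
    ; home           = proj₁
    ; test           = λ s μ → planTest (planFor s μ)
    ; next           = λ s μ → planNext (planFor s μ)
    ; act            = λ s μ → planAct (planFor s μ)
    }

-- True claims are won and false claims are lost

module ClaimGame {A : Alphabet} (M : Machine A) (D′ : ℕ) (w : Word A) where
  open Machine M
  open InputTape A w
  open Counter A w
  open Run M w hiding (N)
  open Play (claimGame M D′) w

  D : ℕ
  D = suc D′

  clockDigits indexDigits : Placement → Fin D → Fin N
  clockDigits pos d = pos (clockHead d)
  indexDigits pos d = pos (indexHead d)

  clockValue indexValue : Placement → ℕ
  clockValue pos = value (clockDigits pos)
  indexValue pos = value (indexDigits pos)

  planMoved : Plan M D′ → Placement → Bool → Placement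
  planMoved p pos b h = applyAction (planAct M D′ p b h) (pos h)

  scanned-index : ∀ p pos → indexValue (planMoved p pos true) ≡ 0
  scanned-index p pos = value-▷ D

  origin-inherit : ∀ d a z (p : Fin D → Fin N) → let (I , o) = inherit M D′ d a z in Passes I p →
    origin d (address a (value p)) ≡ Maybe.map (λ a′ → address a′ (value (result I p))) o
  origin-inherit stay  stay  z        p ok = refl
  origin-inherit stay  left  z        p ok = refl
  origin-inherit stay  right z        p ok = refl
  origin-inherit left  stay  z        p ok = cong (just ∘ onLeft) (≡-sym (value-▷ D))
  origin-inherit right stay  z        p ok = cong (just ∘ onRight) (≡-sym (value-▷ D))
  origin-inherit left  left  nothing  p ok = contradiction (ok zero) λ ()
  origin-inherit left  left  (just j) p ok = cong (just ∘ onLeft) (shift-sound ◁-end j p ok)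
  origin-inherit left  right nothing  p ok = cong (origin left ∘ onRight) (ifZero-sound p ok)
  origin-inherit left  right (just j) p ok = cong (origin left ∘ onRight) (shift-sound ▷-end j p ok)
  origin-inherit right left  nothing  p ok = cong (origin right ∘ onLeft) (ifZero-sound p ok)
  origin-inherit right left  (just j) p ok = cong (origin right ∘ onLeft) (shift-sound ▷-end j p ok)
  origin-inherit right right nothing  p ok = contradiction (ok zero) λ ()
  origin-inherit right right (just j) p ok = cong (just ∘ onRight) (shift-sound ◁-end j p ok)

  Inheritable : Direction → Direction → (Fin D → Fin N) → Set
  Inheritable d a p = ∃[ z ] let I = proj₁ (inherit M D′ d a z) in Passes I p × value (result I p) ≤ suc (value p)

  incrementable : ∀ (p : Fin D → Fin N) → suc (value p) < N ^ D →
    ∃[ j ] Passes (shift ◁-end j) p × value (result (shift ◁-end j) p) ≤ suc (value p)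
  incrementable p v<max with j , ok ← inc-complete p v<max = j , ok , ℕ.≤-reflexive (≡-sym (shift-sound ◁-end j p ok))

  decrementable : ∀ (p : Fin D → Fin N) → value p ≢ 0 →
    ∃[ j ] Passes (shift ▷-end j) p × value (result (shift ▷-end j) p) ≤ suc (value p)
  decrementable p v≢0 with j , ok ← dec-complete p v≢0 =
    j , ok , ℕ.≤-trans (ℕ.n≤1+n _) (ℕ.≤-trans (ℕ.≤-reflexive (≡-sym (shift-sound ▷-end j p ok))) (ℕ.n≤1+n _))

  inheritable : ∀ d a (p : Fin D → Fin N) → suc (value p) < N ^ D → Inheritable d a p
  inheritable stay  stay  p _ = nothing , (λ _ → refl) , ℕ.n≤1+n _
  inheritable stay  left  p _ = nothing , (λ _ → refl) , ℕ.n≤1+n _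
  inheritable stay  right p _ = nothing , (λ _ → refl) , ℕ.n≤1+n _
  inheritable left  stay  p _ = nothing , (λ _ → refl) , ℕ.≤-trans (ℕ.≤-reflexive (value-▷ D)) z≤n
  inheritable right stay  p _ = nothing , (λ _ → refl) , ℕ.≤-trans (ℕ.≤-reflexive (value-▷ D)) z≤n
  inheritable left  left  p v<max with j , ok ← incrementable p v<max = just j , ok
  inheritable right right p v<max with j , ok ← incrementable p v<max = just j , ok
  inheritable left  right p _ with value p ℕ.≟ 0
  ... | yes v≡0 = nothing , ifZero-complete p v≡0 , ℕ.n≤1+n _
  ... | no  v≢0 with j , ok ← decrementable p v≢0 = just j , ok
  inheritable right left  p _ with value p ℕ.≟ 0
  ... | yes v≡0 = nothing , ifZero-complete p v≡0 , ℕ.n≤1+n _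
  ... | no  v≢0 with j , ok ← decrementable p v≢0 = just j , ok

  value-low : ∀ (p : Fin D → Fin N) → value (p ∘ suc) ≡ 0 → value p ≡ toℕ (p zero)
  value-low p v≡0 = trans (cong (λ x → toℕ (p zero) + N * x) v≡0)
    (trans (cong (toℕ (p zero) +_) (ℕ.*-zeroʳ N)) (ℕ.+-identityʳ _))

  value-high : ∀ (p : Fin D → Fin N) → value (p ∘ suc) ≢ 0 → N ≤ value p
  value-high p v≢0 = ℕ.≤-trans (ℕ.m≤m*n N (value (p ∘ suc)) {{ℕ.≢-nonZero v≢0}}) (ℕ.m≤n+m _ (toℕ (p zero)))

  initialCheck-sound : ∀ a {x} z (p : Fin D → Fin N) → Passes (initialCheck M D′ a x z) p → initialTape (address a (value p)) ≡ x
  initialCheck-sound left  z       p ok = true⇒ (finite⇒≟ content-finite _ _) (ok zero)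
  initialCheck-sound stay  z       p ok = true⇒ (finite⇒≟ content-finite _ _) (ok zero)
  initialCheck-sound right nothing p ok = trans (cong (initialTape ∘ onRight) (value-low p (ifZero-sound (p ∘ suc) (ok ∘ suc))))
    (trans (initialTape-input (p zero)) (true⇒ (finite⇒≟ content-finite _ _) (ok zero)))
  initialCheck-sound right (just j) p ok = trans
    (initialTape-beyond (value-high p (λ v≡0 → ℕ.1+n≢0 (trans (≡-sym (shift-sound ▷-end j (p ∘ suc) (ok ∘ suc))) v≡0))))
    (true⇒ (finite⇒≟ content-finite _ _) (ok zero))

  initialCheck-complete : ∀ a {x} (p : Fin D → Fin N) → initialTape (address a (value p)) ≡ x →
    ∃[ z ] Passes (initialCheck M D′ a x z) p
  initialCheck-complete left  p eq = nothing , λ _ → dec-true (finite⇒≟ content-finite _ _) eq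
  initialCheck-complete stay  p eq = nothing , λ _ → dec-true (finite⇒≟ content-finite _ _) eq
  initialCheck-complete right {x} p eq with value (p ∘ suc) ℕ.≟ 0
  ... | yes v≡0 = nothing , ok
    where
    ok : Passes (check (inputTest M D′ x)) p
    ok zero    = dec-true (finite⇒≟ content-finite _ _)
      (trans (≡-sym (initialTape-input (p zero))) (trans (cong (initialTape ∘ onRight) (≡-sym (value-low p v≡0))) eq))
    ok (suc d) = ifZero-complete (p ∘ suc) v≡0 d
  ... | no v≢0 with j , upper ← dec-complete (p ∘ suc) v≢0 = just j , ok
    where
    ok : Passes (check (beyondTest M D′ x j)) p
    ok zero    = dec-true (finite⇒≟ content-finite _ _) (trans (≡-sym (initialTape-beyond (value-high p v≢0))) eq)
    ok (suc d) = upper d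

  win-by : ∀ {s pos} μ {p} → planFor M D′ s μ ≡ p →
    Passes (Plan.clock p) (clockDigits pos) → Passes (Plan.index p) (indexDigits pos) →
    (∀ b s′ → planNext M D′ p b ≡ just s′ → Win s′ (planMoved p pos b)) → Win s pos
  win-by μ refl ticks ok = win μ λ { (clockHead d) → ticks d ; (indexHead d) → ok d }

  guard-yes : ∀ {X : Set} (X? : Dec X) {p} → X → guard M D′ X? p ≡ p
  guard-yes (yes _) x = refl
  guard-yes (no ¬x) x = contradiction x ¬x

  tick-complete : ∀ {pos t} → clockValue pos ≡ suc t →
    ∃[ j ] Passes (shift ▷-end j) (clockDigits pos) × value (result (shift ▷-end j) (clockDigits pos)) ≡ t
  tick-complete {pos} eq with j , ok ← dec-complete (clockDigits pos) (λ v≡0 → ℕ.1+n≢0 (trans (≡-sym eq) v≡0)) =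
    j , ok , ℕ.suc-injective (trans (≡-sym (shift-sound ▷-end j (clockDigits pos) ok)) eq)

  -- A step back in time takes one off the clock and adds at most one to the index, so their sum
  -- stays below `N ^ D` and the index never overflows.
  win-claim : ∀ t {q a x pos} → clockValue pos ≡ t → indexValue pos + t < N ^ D →
    Holds (run t) q (address a (indexValue pos)) x → Win (claim q a x) pos
  win-claim zero {q} {a} {x} {pos} clock≡0 _ (start≡q , eq)
    with z , ok ← initialCheck-complete a (indexDigits pos) eq =
    win-by (base z) (guard-yes (finite⇒≟ state-finite start q) start≡q)
      (ifZero-complete (clockDigits pos) clock≡0) ok (λ { true s′ () ; false s′ () })
  win-claim (suc t) {q} {a} {x} {pos} clock≡ small h
    with q′ , y , y′ , d , scans , δ≡ , inh ← holds-unstep (run t) h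
    with j , ticks , clock′≡ ← tick-complete {pos} clock≡
    with z , ok , small′ ← inheritable d a (indexDigits pos)
           (ℕ.≤-<-trans (ℕ.≤-trans (s≤s (ℕ.m≤m+n _ t)) (ℕ.≤-reflexive (≡-sym (ℕ.+-suc (indexValue pos) t)))) small) =
    go (inherit M D′ d a z) refl
    where
    I = proj₁ (inherit M D′ d a z)
    t<max : t < N ^ D
    t<max = ℕ.<-trans (ℕ.≤-<-trans (ℕ.m≤n+m t (indexValue pos)) (ℕ.+-monoʳ-< (indexValue pos) (ℕ.n<1+n t))) small
    index+t<max : ∀ {v} → v ≤ suc (indexValue pos) → v + t < N ^ D
    index+t<max v≤ = ℕ.≤-<-trans (ℕ.≤-trans (ℕ.+-monoˡ-≤ t v≤) (ℕ.≤-reflexive (≡-sym (ℕ.+-suc (indexValue pos) t)))) small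
    win-scanned : ∀ p → Plan.clock p ≡ shift ▷-end j → Win (claim q′ stay y) (planMoved p pos true)
    win-scanned p refl = win-claim t {pos = planMoved p pos true} clock′≡ (subst (λ v → v + t < N ^ D) (≡-sym (scanned-index p pos)) t<max) scans
    inherited : Inherited (run t) q′ x y′ (Maybe.map (λ a′ → address a′ (value (result I (indexDigits pos)))) (proj₂ (inherit M D′ d a z)))
    inherited = subst (Inherited (run t) q′ x y′) (origin-inherit d a z (indexDigits pos) ok) inh
    planned : ∀ {o} → inherit M D′ d a z ≡ o →
      planFor M D′ (claim q a x) (before j q′ y z) ≡ planOrigin M D′ j q′ y x o (finite⇒≟ content-finite y′ x)
    planned refl = trans (cong (planBefore M D′ j q′ y z q a x) δ≡) (guard-yes (finite⇒≟ state-finite q q) refl)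
    go : ∀ o → inherit M D′ d a z ≡ o → Win (claim q a x) pos
    go (I′ , nothing) eq =
      win-by (before j q′ y z) {p} (trans (planned eq) (guard-yes (finite⇒≟ content-finite y′ x)
          (subst (λ o → Inherited (run t) q′ x y′ (Maybe.map (λ a′ → address a′ (value (result I (indexDigits pos)))) (proj₂ o))) eq inherited)))
        ticks (subst (λ o → Passes (proj₁ o) (indexDigits pos)) eq ok)
        λ { true _ refl → win-scanned p refl ; false _ () }
      where p = plan (shift ▷-end j) I′ (just (claim q′ stay y)) nothing
    go (I′ , just a′) eq =
      win-by (before j q′ y z) {p} (planned eq)
        ticks (subst (λ o → Passes (proj₁ o) (indexDigits pos)) eq ok)
        λ { true _ refl → win-scanned p refl
          ; false _ refl → win-claim t {pos = planMoved p pos false} clock′≡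
              (subst (λ o → value (result (proj₁ o) (indexDigits pos)) + t < N ^ D) eq (index+t<max small′))
              (subst (λ o → Inherited (run t) q′ x y′ (Maybe.map (λ a′ → address a′ (value (result (proj₁ o) (indexDigits pos)))) (proj₂ o))) eq inherited) }
      where p = plan (shift ▷-end j) I′ (just (claim q′ stay y)) (just (claim q′ a′ x))

  win-await : ∀ v {t pos} → clockValue pos ≡ v → v < N ^ D → t < v → AcceptsAt t → Win await pos
  win-await (suc v) {t} {pos} clock≡ v<max t<v accepts@(q , y , scans , δ≡)
    with j , ticks , clock′≡ ← tick-complete {pos} clock≡ | ℕ.m≤n⇒m<n∨m≡n (ℕ.s≤s⁻¹ t<v)
  ... | inj₁ t<v′ = win-by (later j) refl ticks (λ _ → refl)
    λ { true _ refl → win-await v clock′≡ (ℕ.<-trans (ℕ.n<1+n v) v<max) t<v′ accepts ; false _ () }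
  ... | inj₂ refl = win-by (before j q y nothing) {p} (cong (planAccept M D′ j q y) δ≡) ticks (λ _ → refl)
    λ { true _ refl → win-claim t {pos = planMoved p pos true} clock′≡
          (subst (λ x → x + t < N ^ D) (≡-sym (scanned-index p pos)) (ℕ.<-trans (ℕ.n<1+n t) v<max)) scans
      ; false _ () }
    where p = plan (shift ▷-end j) keep (just (claim q stay y)) nothing

  Refuted : Plan M D′ → Placement → Set
  Refuted p pos = Passes (Plan.clock p) (clockDigits pos) → Passes (Plan.index p) (indexDigits pos) →
    ∃[ b ] ∃[ s′ ] planNext M D′ p b ≡ just s′ × Lose s′ (planMoved p pos b)

  lose-by : ∀ {s pos} → (∀ μ → Refuted (planFor M D′ s μ) pos) → Lose s pos
  lose-by refuted = lose λ μ ok → refuted μ (λ d → ok (clockHead d)) (λ d → ok (indexHead d))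

  refuted-failing : ∀ {pos} → Refuted (failing M D′) pos
  refuted-failing ticks = contradiction (ticks zero) λ ()

  refuted-guard : ∀ {X : Set} {pos} (X? : Dec X) {p} → (X → Refuted p pos) → Refuted (guard M D′ X? p) pos
  refuted-guard       (yes x) r = r x
  refuted-guard {pos = pos} (no _)  r = refuted-failing {pos}

  Wrong : ℕ → State → Direction → Content → Placement → Set
  Wrong t q a x pos = clockValue pos ≡ t × ¬ Holds (run t) q (address a (indexValue pos)) x

  Loses : ℕ → Set
  Loses t = ∀ {q a x pos} → Wrong t q a x pos → Lose (claim q a x) pos

  ticked : ∀ {pos v j} → clockValue pos ≡ suc v → Passes (shift ▷-end j) (clockDigits pos) →
    value (result (shift ▷-end j) (clockDigits pos)) ≡ v
  ticked {pos} {j = j} clock≡ ok = ℕ.suc-injective (trans (≡-sym (shift-sound ▷-end j (clockDigits pos) ok)) clock≡)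

  -- At clock value 0 no digit can stop a borrow. The prover is then forced to appeal to the input
  -- and cannot prolong a lie.
  not-ticked : ∀ {X : Set} {pos j} → clockValue pos ≡ 0 → Passes (shift ▷-end j) (clockDigits pos) → X
  not-ticked {pos = pos} {j} clock≡0 ok = contradiction (trans (≡-sym (shift-sound ▷-end j (clockDigits pos) ok)) clock≡0) ℕ.1+n≢0

  -- If the claim on the scanned symbol and the inherited one both held, `holds-step` would make the
  -- present claim true. `holds?` decides which of them to doubt.
  refuted-origin : ∀ {t q q′ a x y y′ d pos} j z → Loses t → Wrong (suc t) q a x pos → δ q′ y ≡ continue (q , y′ , d) →
    Refuted (planOrigin M D′ j q′ y x (inherit M D′ d a z) (finite⇒≟ content-finite y′ x)) pos
  refuted-origin {t} {q} {q′} {a} {x} {y} {y′} {d} {pos} j z loses (clock≡ , ¬holds) δ≡ = go (inherit M D′ d a z) refl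
    where
    doubt-scanned : ∀ p → Plan.clock p ≡ shift ▷-end j → Passes (Plan.clock p) (clockDigits pos) → ¬ Holds (run t) q′ scanned y →
      Lose (claim q′ stay y) (planMoved p pos true)
    doubt-scanned p refl ok ¬scans = loses (ticked {pos} {j = j} clock≡ ok , ¬scans)
    ¬inherited : ∀ I o → inherit M D′ d a z ≡ (I , o) → Passes I (indexDigits pos) → Holds (run t) q′ scanned y →
      ¬ Inherited (run t) q′ x y′ (Maybe.map (λ a′ → address a′ (value (result I (indexDigits pos)))) o)
    ¬inherited I o refl ok scans inh = ¬holds (holds-step (run t) {d = d} {a = address a (indexValue pos)} scans δ≡
      (subst (Inherited (run t) q′ x y′) (≡-sym (origin-inherit d a z (indexDigits pos) ok)) inh))
    go : ∀ o → inherit M D′ d a z ≡ o → Refuted (planOrigin M D′ j q′ y x o (finite⇒≟ content-finite y′ x)) pos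
    go (I , nothing) eq = refuted-guard {pos = pos} (finite⇒≟ content-finite y′ x) λ y′≡x ticks ok →
      let p = plan (shift ▷-end j) I (just (claim q′ stay y)) nothing in
      true , _ , refl , doubt-scanned p refl ticks
        λ scans → ¬inherited I nothing eq ok scans y′≡x
    go (I , just a′) eq ticks ok with holds? (run t) q′ scanned y
    ... | no ¬scans = true , _ , refl , doubt-scanned p refl ticks ¬scans
      where p = plan (shift ▷-end j) I (just (claim q′ stay y)) (just (claim q′ a′ x))
    ... | yes scans = false , _ , refl , loses {pos = planMoved p pos false}
        (ticked {pos} {j = j} clock≡ ticks , ¬inherited I (just a′) eq ok scans)
      where p = plan (shift ▷-end j) I (just (claim q′ stay y)) (just (claim q′ a′ x))

  refuted-origin-0 : ∀ {X : Set} {q x y pos} j o (X? : Dec X) → clockValue pos ≡ 0 → Refuted (planOrigin M D′ j q y x o X?) pos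
  refuted-origin-0 {pos = pos} j (I , nothing) X? clock≡0 = refuted-guard {pos = pos} X?
    λ _ ticks _ → not-ticked {pos = pos} {j} clock≡0 ticks
  refuted-origin-0 {pos = pos} j (I , just _)  X? clock≡0 ticks _ = not-ticked {pos = pos} {j} clock≡0 ticks

  refuted-before : ∀ {t q q′ a x y pos} j z → (∀ {t′} → t ≡ suc t′ → Loses t′) → Wrong t q a x pos → ∀ o → δ q′ y ≡ o →
    Refuted (planBefore M D′ j q′ y z q a x o) pos
  refuted-before {pos = pos} j z loses wrong (halt _) δ≡ = refuted-failing {pos}
  refuted-before {zero} {q} {a = a} {x} {pos = pos} j z loses (clock≡0 , _) (continue (q₁ , y′ , d)) δ≡ =
    refuted-guard {pos = pos} (finite⇒≟ state-finite q₁ q) λ _ →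
      refuted-origin-0 {pos = pos} j (inherit M D′ d a z) (finite⇒≟ content-finite y′ x) clock≡0
  refuted-before {suc t} {q} {pos = pos} j z loses wrong (continue (q₁ , y′ , d)) δ≡ =
    refuted-guard {pos = pos} (finite⇒≟ state-finite q₁ q) λ { refl → refuted-origin {pos = pos} j z (loses refl) wrong δ≡ }

  refuted-base : ∀ {t q a x pos} z → Wrong t q a x pos →
    Refuted (guard M D′ (finite⇒≟ state-finite start q) (plan ifZero (initialCheck M D′ a x z) nothing nothing)) pos
  refuted-base {t} {q} {a} {x} {pos} z (clock≡ , ¬holds) = refuted-guard {pos = pos} (finite⇒≟ state-finite start q) λ start≡q ticks ok →
    contradiction (subst (λ t → Holds (run t) q (address a (indexValue pos)) x)
        (trans (≡-sym (ifZero-sound (clockDigits pos) ticks)) clock≡)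
        (start≡q , initialCheck-sound a z (indexDigits pos) ok))
      ¬holds

  -- The hypothesis on earlier times is vacuous at time 0, so one argument serves both cases of
  -- `lose-claim`.
  refuted-claim : ∀ {t q a x pos} → (∀ {t′} → t ≡ suc t′ → Loses t′) → Wrong t q a x pos →
    ∀ μ → Refuted (planFor M D′ (claim q a x) μ) pos
  refuted-claim {pos = pos} loses wrong (base z)          = refuted-base {pos = pos} z wrong
  refuted-claim {pos = pos} loses wrong (later j)         = refuted-failing {pos}
  refuted-claim {pos = pos} loses wrong (before j q′ y z) = refuted-before {pos = pos} j z loses wrong (δ q′ y) refl

  lose-claim : ∀ t → Loses t
  lose-claim zero    wrong = lose-by (refuted-claim (λ ()) wrong)
  lose-claim (suc t) wrong = lose-by (refuted-claim (λ { refl → lose-claim t }) wrong)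

  refuted-accept : ∀ {v pos} → (∀ t → ¬ AcceptsAt t) → clockValue pos ≡ v → ∀ j q y o → δ q y ≡ o → Refuted (planAccept M D′ j q y o) pos
  refuted-accept {zero}  {pos} rejects clock≡ j q y (halt accept) δ≡ ticks _ = not-ticked {pos = pos} {j} clock≡ ticks
  refuted-accept {suc v} {pos} rejects clock≡ j q y (halt accept) δ≡ ticks _ =
    true , _ , refl , lose-claim v (ticked {pos} {j = j} clock≡ ticks , λ scans → rejects v (q , y , scans , δ≡))
  refuted-accept {_} {pos} rejects clock≡ j q y (halt reject) δ≡ = refuted-failing {pos}
  refuted-accept {_} {pos} rejects clock≡ j q y (continue _)  δ≡ = refuted-failing {pos}

  lose-await : (∀ t → ¬ AcceptsAt t) → ∀ v {pos} → clockValue pos ≡ v → Lose await pos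
  lose-await rejects v {pos} clock≡ = lose-by (refuted v clock≡)
    where
    refuted : ∀ v → clockValue pos ≡ v → ∀ μ → Refuted (planFor M D′ await μ) pos
    refuted v       clock≡ (base _)         = refuted-failing {pos}
    refuted zero    clock≡ (later j) ticks _ = not-ticked {pos = pos} {j} clock≡ ticks
    refuted (suc v) clock≡ (later j) ticks _ = true , _ , refl , lose-await rejects v (ticked {pos} {j = j} clock≡ ticks)
    refuted v       clock≡ (before j q y _) = refuted-accept {v} {pos} rejects clock≡ j q y (δ q y) refl

  game-won : ∀ {t} → suc t < N ^ D → AcceptsAt t → Win await homes
  game-won {t} t<max accepts = win-await (clockValue homes) refl (ℕ.≤-reflexive (value-◁ D))
    (ℕ.s≤s⁻¹ (ℕ.≤-trans t<max (ℕ.≤-reflexive (≡-sym (value-◁ D))))) accepts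

  game-lost : (∀ t → ¬ AcceptsAt t) → Lose await homes
  game-lost rejects = lose-await rejects (clockValue homes) refl

-- Turing machines

-- Two preliminary steps bring the head from the blank start cell to the first
-- input symbol.
relative : ∀ {A} → TuringMachine A → Machine A
relative {A} M = record
  { State          = Maybe (Maybe State)
  ; Content        = Cell
  ; state-finite   = Maybe-finite (Maybe-finite state-finite)
  ; content-finite = Maybe-finite (⊎-finite (_ , Alphabet.finite A) work-finite)
  ; start          = nothing
  ; blank          = nothing
  ; embed          = λ { ▷ → nothing ; ◁ → nothing ; (sym a) → just (inj₁ a) }
  ; δ              = λ { nothing _ → continue (just nothing , nothing , right)
                       ; (just nothing) _ → continue (just (just start) , nothing , right)
                       ; (just (just q)) x → lift (δ q x) }
  }
  where
  open TuringMachine M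
  lift : Outcome (State × Cell × Direction) → Outcome (Maybe (Maybe State) × Cell × Direction)
  lift (halt v)               = halt v
  lift (continue (q , y , d)) = continue (just (just q) , y , d)

module Simulation {A : Alphabet} (M : TuringMachine A) (w : Word A) where
  open TuringMachine M using (Cell; δ; start)
  open TM M using (Tape; tape; inputSymbol)
  open InputTape A w using (closed)
  private
    module T = TM M
    module R = Run (relative M) w
  open Machine (relative M) using (embed)

  nth : List Cell → ℕ → Cell
  nth []       _       = nothing
  nth (x ∷ _)  zero    = x
  nth (_ ∷ xs) (suc i) = nth xs i

  look : Tape → Address → Cell
  look (tape ls x rs) scanned     = x
  look (tape ls x rs) (onLeft i)  = nth ls i
  look (tape ls x rs) (onRight i) = nth rs i

  -- The lists of a tape already hold its cells by distance from the head, so a move renames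
  -- addresses exactly as `origin` does.
  look-move : ∀ d ls x y rs a → look (T.move d (tape ls y rs)) a ≡ maybe′ (look (tape ls x rs)) y (origin d a)
  look-move left  []       x y rs       scanned           = refl
  look-move left  []       x y rs       (onLeft i)        = refl
  look-move left  []       x y rs       (onRight zero)    = refl
  look-move left  []       x y rs       (onRight (suc i)) = refl
  look-move left  (l ∷ ls) x y rs       scanned           = refl
  look-move left  (l ∷ ls) x y rs       (onLeft i)        = refl
  look-move left  (l ∷ ls) x y rs       (onRight zero)    = refl
  look-move left  (l ∷ ls) x y rs       (onRight (suc i)) = refl
  look-move stay  ls       x y rs       scanned           = refl
  look-move stay  ls       x y rs       (onLeft i)        = refl
  look-move stay  ls       x y rs       (onRight i)       = refl
  look-move right ls       x y []       scanned           = refl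
  look-move right ls       x y []       (onLeft zero)     = refl
  look-move right ls       x y []       (onLeft (suc i))  = refl
  look-move right ls       x y []       (onRight i)       = refl
  look-move right ls       x y (r ∷ rs) scanned           = refl
  look-move right ls       x y (r ∷ rs) (onLeft zero)     = refl
  look-move right ls       x y (r ∷ rs) (onLeft (suc i))  = refl
  look-move right ls       x y (r ∷ rs) (onRight i)       = refl

  nth-closed : ∀ (u : Word A) i → embed (lookup (closed (fromList u)) i) ≡ nth (List.map inputSymbol u) (toℕ i)
  nth-closed []      zero    = refl
  nth-closed (a ∷ u) zero    = refl
  nth-closed (a ∷ u) (suc i) = nth-closed u i

  nth-beyond : ∀ (u : Word A) i → length u ≤ i → nth (List.map inputSymbol u) i ≡ nothing
  nth-beyond []      i       _         = refl
  nth-beyond (a ∷ u) (suc i) (s≤s u≤i) = nth-beyond u i u≤i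

  initial-right : ∀ i → nth (List.map inputSymbol w) i ≡ R.initialTape (onRight (suc i))
  initial-right i with suc i ℕ.<? R.N
  ... | yes (s≤s i<) = trans (cong (nth (List.map inputSymbol w)) (≡-sym (toℕ-fromℕ< i<))) (≡-sym (nth-closed w (fromℕ< i<)))
  ... | no  i≮       = nth-beyond w i (ℕ.≤-trans (ℕ.n≤1+n _) (ℕ.s≤s⁻¹ (ℕ.≮⇒≥ i≮)))

  look-scanned : ∀ u → look (T.initialTape u) scanned ≡ nth (List.map inputSymbol u) 0
  look-scanned []      = refl
  look-scanned (_ ∷ _) = refl

  look-onLeft : ∀ u i → look (T.initialTape u) (onLeft i) ≡ nothing
  look-onLeft []      _ = refl
  look-onLeft (_ ∷ _) _ = refl

  look-onRight : ∀ u i → look (T.initialTape u) (onRight i) ≡ nth (List.map inputSymbol u) (suc i)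
  look-onRight []      _ = refl
  look-onRight (_ ∷ _) _ = refl

  data Simulates : T.Config → R.Config → Set where
    halted  : ∀ {v} → Simulates (halt v) (halt v)
    running : ∀ {q T f} → (∀ a → look T a ≡ f a) → Simulates (continue (q , T)) (continue (just (just q) , f))

  simulates-start : Simulates (T.run 0 w) (R.run 2)
  simulates-start = running λ
    { scanned                 → trans (look-scanned w) (initial-right 0)
    -- The two nearest cells on the left are the one of ▷ and the start cell, both left blank by the
    -- preliminary steps.
    ; (onLeft zero)           → look-onLeft w 0
    ; (onLeft (suc zero))     → look-onLeft w 1
    ; (onLeft (suc (suc i)))  → look-onLeft w (2 + i)
    ; (onRight i)             → trans (look-onRight w i) (initial-right (suc i)) }

  simulates-step : ∀ {C C′} → Simulates C C′ → Simulates (T.step C) (R.step C′)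
  simulates-step halted = halted
  simulates-step (running {q} {tape ls x rs} {f} same) rewrite ≡-sym (same scanned) with δ q x
  ... | halt v               = halted
  ... | continue (q′ , y , d) = running λ a → trans (look-move d ls x y rs a) (pointwise (origin d a))
    where
    pointwise : ∀ o → maybe′ (look (tape ls x rs)) y o ≡ maybe′ f y o
    pointwise nothing  = refl
    pointwise (just a) = same a

  simulates : ∀ t → Simulates (T.run t w) (R.run (t + 2))
  simulates zero    = simulates-start
  simulates (suc t) = simulates-step (simulates t)

  halts : ∀ {v} t → T.HaltsWith v (T.run t w) → R.run (t + 2) ≡ halt v
  halts t = go (simulates t)
    where
    go : ∀ {v C C′} → Simulates C C′ → T.HaltsWith v C → C′ ≡ halt v
    go halted T.halted = refl

-- Enough digits for polynomial time

n<N^n : ∀ {N} → 2 ≤ N → ∀ n → n < N ^ n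
n<N^n 2≤N zero    = s≤s z≤n
n<N^n {N} 2≤N (suc n) = ℕ.≤-trans
  (ℕ.+-mono-≤ (ℕ.≤-trans (s≤s z≤n) (n<N^n 2≤N n)) (ℕ.≤-trans (n<N^n 2≤N n) (ℕ.m≤m+n (N ^ n) 0)))
  (ℕ.*-monoˡ-≤ (N ^ n) 2≤N)

-- With base `N`, `k` digits absorb the power of the input length, `3 + c` digits a factor 3 + c by
-- `n<N^n`, and the extra digit in `suc (digits c k)` a factor 2, as `N` is at least 2 even for the
-- empty word.
digits : ℕ → ℕ → ℕ
digits c k = 3 + c + k

-- The summand 2 accounts for the preliminary steps of `relative`.
polynomial<power : ∀ c k n → c * n ^ k + c + 2 < (2 + n) ^ suc (digits c k)
polynomial<power c k n = begin-strict
  c * n ^ k + c + 2              ≤⟨ ℕ.+-mono-≤ (ℕ.+-mono-≤ (ℕ.*-monoʳ-≤ c n^k≤X) (ℕ.m≤m*n c X {{X≢0}})) (ℕ.m≤m*n 2 X {{X≢0}}) ⟩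
  c * X + c * X + 2 * X          ≤⟨ ℕ.+-monoʳ-≤ (c * X + c * X) (ℕ.*-monoˡ-≤ X {2} {6} (s≤s (s≤s z≤n))) ⟩
  c * X + c * X + 6 * X          ≡⟨ solve 2 (λ c X → c :* X :+ c :* X :+ con 6 :* X := con 2 :* ((con 3 :+ c) :* X)) refl c X ⟩
  2 * ((3 + c) * X)              <⟨ ℕ.*-monoʳ-< 2 (ℕ.*-monoˡ-< X {{X≢0}} (n<N^n 2≤N (3 + c))) ⟩
  2 * (N ^ (3 + c) * X)          ≤⟨ ℕ.*-monoˡ-≤ (N ^ (3 + c) * X) 2≤N ⟩
  N * (N ^ (3 + c) * N ^ k)      ≡⟨ cong (N *_) (ℕ.^-distribˡ-+-* N (3 + c) k) ⟨
  N ^ suc (3 + c + k)            ∎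
  where
  open ℕ.≤-Reasoning
  open ℕ-Solver.+-*-Solver
  N = 2 + n
  X = N ^ k
  X≢0 = ℕ.m^n≢0 N k
  2≤N : 2 ≤ N
  2≤N = s≤s (s≤s z≤n)
  n^k≤X : n ^ k ≤ X
  n^k≤X = ℕ.^-monoˡ-≤ k (ℕ.m≤n+m n 2)

module _ {A : Alphabet} (M : TuringMachine A) (c k : ℕ) (w : Word A) where
  open Game (claimGame (relative M) (digits c k))
  open Play (claimGame (relative M) (digits c k)) w
  open ClaimGame (relative M) (digits c k) w using (game-won; game-lost)
  private
    module R = Run (relative M) w

  accepted⇒won : ∀ {t} → t ≤ c * length w ^ k + c → TM.HaltsWith M accept (TM.run M t w) → Win initial homes
  accepted⇒won {t} t≤T accepts = won (R.accepted⇒AcceptsAt (t + 2) (Simulation.halts M w t accepts))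
    where
    won : (∃[ t′ ] t′ < t + 2 × R.AcceptsAt t′) → Win initial homes
    won (t′ , t′<t+2 , accepting) =
      game-won (ℕ.≤-<-trans (ℕ.≤-trans t′<t+2 (ℕ.+-monoˡ-≤ 2 t≤T)) (polynomial<power c k (length w))) accepting

  rejected⇒lost : ∀ {t} → TM.HaltsWith M reject (TM.run M t w) → Lose initial homes
  rejected⇒lost {t} rejects = game-lost (R.rejected⇒¬AcceptsAt {t + 2} (Simulation.halts M w t rejects))

theorem7 : (A : Alphabet) (L : Language A) → InP A L →
    (ε : ℝ) → Positive ε →
    Σ[ V ∈ Verifier A ] Σ[ c ∈ ℕ ]
    (TossesAtMost V c
    × (∀ w → L w → Σ[ P ∈ Prover V ] (∀ (R : Refuter V) → acc V P R w ≈ fromℚ 1ℚ))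
    × (∀ w → ¬ L w → ∀ (P : Prover V) → Σ[ R ∈ Refuter V ] rej V P R w ≥ (1- ε)))
theorem7 A L (M , c , k , decides) = game⇒verifiable L G (λ w → wins w (decides w)) (λ w → loses w (decides w))
  where
  G = claimGame (relative M) (digits c k)
  open Game G using (initial)
  Decided : Word A → Set
  Decided w = ∃[ t ] t ≤ c * length w ^ k + c ×
    ((L w × TM.HaltsWith M accept (TM.run M t w)) ⊎ (¬ L w × TM.HaltsWith M reject (TM.run M t w)))
  wins : ∀ w → Decided w → L w → Play.Win G w initial (Play.homes G w)
  wins w (t , t≤T , inj₁ (_ , accepts)) _   = accepted⇒won M c k w {t} t≤T accepts
  wins w (_ , _   , inj₂ (w∉L , _))     w∈L = contradiction w∈L w∉L
  loses : ∀ w → Decided w → ¬ L w → Play.Lose G w initial (Play.homes G w)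
  loses w (_ , _ , inj₁ (w∈L , _))     w∉L = contradiction w∈L w∉L
  loses w (t , _ , inj₂ (_ , rejects)) _   = rejected⇒lost M c k w {t} rejects
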